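{- Let $k\in\mathbb{N}$. If a connected graph $G$ contains no $(\ge 3k)$-subdivision of $K_{1,3}$ as a $3$-quasi-geodesic subgraph, then there is a graph $C$ that is a cycle or a path such that $G$ admits an honest $C$-decomposition of radial width at most $18k+2$ and radial spread at most $36k+2$. Moreover, $C$ is $(1,18k+2)$-quasi-isometric to $G$.
   Context: All graphs are finite and simple; $\mathbb{N}=\{0,1,2,\dots\}$. $d_G$ denotes the distance in $G$. A path may consist of a single vertex. A $(\ge k)$-subdivision of a graph $X$ is a graph obtained from $X$ by replacing every edge with a path of length at least $k+1$ (new paths being internally disjoint from each other and from $V(X)$). A subgraph $Y$ of $G$ is $c$-quasi-geodesic in $G$ if $d_Y(u,v)\le c\cdot d_G(u,v)$ for all $u,v\in V(Y)$. Graph-decompositions: an $H$-decomposition of $G$ is a pair $(H,(V_h)_{h\in V(H)})$ with $H$ a graph and $V_h\subseteq V(G)$ (the bags) such that $\bigcup_{h}G[V_h]=G$ and, for every $v\in V(G)$, the graph $H_v:=H[\{h: v\in V_h\}]$ is connected. It is honest if all bags are non-empty and $V_h\cap V_{h'}\ne\emptyset$ for every edge $hh'$ of $H$. The radius $\mathrm{rad}(G)$ of a graph is the least $r\in\mathbb N$ such that some vertex has distance at most $r$ to all vertices ($\infty$ if the graph is disconnected). The radial width of the decomposition is $\max_h \mathrm{rad}(G[V_h])$ and its radial spread is $\max_{v\in V(G)}\mathrm{rad}(H_v)$. Quasi-isometry: for integers $L\ge1$, $D\ge0$, a graph $A$ is $(L,D)$-quasi-isometric to a graph $B$ if there is a map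 $\varphi:V(A)\to V(B)$ such that for all $a,a'\in V(A)$: $d_A(a,a')\le L\,d_B(\varphi(a),\varphi(a'))+LD$ and $d_B(\varphi(a),\varphi(a'))\le L\,d_A(a,a')+D$; and every $b\in V(B)$ satisfies $d_B(b,\varphi(a))\le D$ for some $a\in V(A)$. -}

module Defs where

open import Data.Bool.Base using (if_then_else_)
open import Data.Fin.Base as Fin using (Fin; zero; suc; fromℕ; inject₁)
open import Data.Fin.Properties using (any?; all?; suc-injective; injective⇒≤; nonZeroIndex) renaming (_≟_ to _≟ᶠ_)
open import Data.Fin.Subset using (Subset; _∈_; _⊆_; _∩_; Nonempty; ⊤)
open import Data.Fin.Subset.Properties using (_∈?_; x∈p∩q⁺; ∈⊤)
import Data.Maybe.Base as Maybe
open import Data.Nat.Base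
  using (ℕ; zero; suc; pred; _+_; _*_; _⊔_; _≤_; _<_; z≤n; s≤s; NonZero)
open import Data.Nat.Properties
  using (_≤?_; ≤-reflexive; ≤-<-trans; <⇒≤pred; suc-pred; ⊔-lub; m⊔n≤o⇒m≤o; m⊔n≤o⇒n≤o)
open import Data.Product.Base using (Σ; ∃; ∃₂; _×_; _,_; proj₁; proj₂)
open import Data.Sum.Base using (_⊎_; inj₁; inj₂)
open import Data.Vec.Base using (tabulate)
import Data.Vec.Functional as Vector
open import Function.Base using (_∘_)
open import Function.Bundles using (_⇔_; mk⇔; module Equivalence)
open import Function.Definitions using (Injective)
open import Level using (0ℓ)
open import Relation.Binary.Core using (Rel)
import Relation.Binary.Construct.Add.Supremum.NonStrict as Supremum
open import Relation.Binary.Definitions using (Decidable; Symmetric; Irreflexive)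
open import Relation.Binary.PropositionalEquality.Core using (_≡_; _≢_; refl; sym; cong; subst)
open import Relation.Nullary.Construct.Add.Supremum using (_⁺; ⊤⁺; [_])
open import Relation.Nullary.Decidable.Core
  using (yes; no; does; map′; _×-dec_; _⊎-dec_; _→-dec_; ¬?)
open import Relation.Nullary.Negation.Core using (¬_; contradiction)
import Relation.Unary as Unary

private
  variable
    b k ℓ m n : ℕ

ℕ∞ : Set
ℕ∞ = ℕ ⁺

infix 4 _≤∞_ _≤∞?_
infixl 6 _+∞_
infixl 7 _*∞_

_≤∞_ : Rel ℕ∞ 0ℓ
_≤∞_ = Supremum._≤⁺_ _≤_

_≤∞?_ : Decidable _≤∞_
_≤∞?_ = Supremum.≤⁺-dec _≤_ _≤?_

_+∞_ : ℕ∞ → ℕ → ℕ∞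
x +∞ c = Maybe.map (_+ c) x

-- Only used with a factor c ≥ 1, so that c · ∞ = ∞.
_*∞_ : ℕ → ℕ∞ → ℕ∞
c *∞ x = Maybe.map (c *_) x

_⊔∞_ : ℕ∞ → ℕ∞ → ℕ∞
_⊔∞_ = Maybe.zipWith _⊔_

max : Subset n → (Fin n → ℕ∞) → ℕ∞
max S f = Vector.foldr _⊔∞_ [ 0 ] (λ i → if does (i ∈? S) then f i else [ 0 ])

-- The least j < b satisfying P, or ∞ if there is none.
least : {P : ℕ → Set} → Unary.Decidable P → ℕ → ℕ∞
least P? zero    = ⊤⁺
least P? (suc b) =
  if does (P? 0) then [ 0 ] else Maybe.map suc (least (P? ∘ suc) b)

data IsLeast (P : ℕ → Set) : ℕ∞ → Set where
  attained : P k → (∀ {j} → P j → k ≤ j) → IsLeast P [ k ]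
  never    : (∀ {j} → ¬ P j) → IsLeast P ⊤⁺

-- The vertex set is a subset of an ambient Fin n, so that a graph and its
-- subgraphs share their vertices.
record Graph (n : ℕ) : Set₁ where
  field
    V          : Subset n
    Adj        : Rel (Fin n) 0ℓ
    Adj?       : Decidable Adj
    Adj⇒∈V     : ∀ {u v} → Adj u v → u ∈ V
    Adj-sym    : Symmetric Adj
    Adj-irrefl : Irreflexive _≡_ Adj

open Graph public

Vertex : Graph n → Set
Vertex G = ∃ (_∈ V G)

infix 4 _⊑_
infixl 8 _↾_

_⊑_ : Graph n → Graph n → Set
Y ⊑ G = V Y ⊆ V G × (∀ {u v} → Adj Y u v → Adj G u v)

_↾_ : Graph n → Subset n → Graph n
G ↾ S = record
  { V          = V G ∩ S
  ; Adj        = λ u v → Adj G u v × u ∈ S × v ∈ S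
  ; Adj?       = λ u v → Adj? G u v ×-dec (u ∈? S) ×-dec (v ∈? S)
  ; Adj⇒∈V     = λ (e , u∈S , _) → x∈p∩q⁺ (Adj⇒∈V G e , u∈S)
  ; Adj-sym    = λ (e , u∈S , v∈S) → Adj-sym G e , v∈S , u∈S
  ; Adj-irrefl = λ u≡v (e , _) → Adj-irrefl G u≡v e
  }

star : (s : ℕ) → Graph (suc s)
star s = record
  { V          = ⊤
  ; Adj        = λ u v → (u ≡ zero × v ≢ zero) ⊎ (u ≢ zero × v ≡ zero)
  ; Adj?       = λ u v → ((u ≟ᶠ zero) ×-dec ¬? (v ≟ᶠ zero))
                           ⊎-dec (¬? (u ≟ᶠ zero) ×-dec (v ≟ᶠ zero))
  ; Adj⇒∈V     = λ _ → ∈⊤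
  ; Adj-sym    = λ { (inj₁ (p , q)) → inj₂ (q , p) ; (inj₂ (p , q)) → inj₁ (q , p) }
  ; Adj-irrefl = λ { refl (inj₁ (p , q)) → q p ; refl (inj₂ (p , q)) → p q }
  }

K₁,₃ : Graph 4
K₁,₃ = star 3

data Walk (G : Graph n) : ℕ → Rel (Fin n) 0ℓ where
  stop : ∀ {u} → u ∈ V G → Walk G 0 u u
  _∷_  : ∀ {u w v} → Adj G u w → Walk G ℓ w v → Walk G (suc ℓ) u v

infixr 5 _∷_

module _ {G : Graph n} where

  at : ∀ {u v} → Walk G ℓ u v → Fin (suc ℓ) → Fin n
  at {u = u} _       zero    = u
  at         (_ ∷ W) (suc i) = at W i

  IsSimple : ∀ {u v} → Walk G ℓ u v → Set
  IsSimple W = Injective _≡_ _≡_ (at W)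

  OnWalk : ∀ {u v} → Walk G ℓ u v → Fin n → Set
  OnWalk W a = ∃ λ i → at W i ≡ a

  Interior : ∀ {u v} → Walk G ℓ u v → Fin n → Set
  Interior {ℓ = ℓ} W a = ∃ λ i → i ≢ zero × i ≢ fromℕ ℓ × at W i ≡ a

  Traverses : ∀ {u v} → Walk G ℓ u v → Rel (Fin n) 0ℓ
  Traverses {ℓ = ℓ} W a b = ∃ λ (i : Fin ℓ) →
    (at W (inject₁ i) ≡ a × at W (suc i) ≡ b) ⊎
    (at W (inject₁ i) ≡ b × at W (suc i) ≡ a)

record Path (G : Graph n) (u v : Fin n) : Set where
  field
    {length} : ℕ
    walk     : Walk G length u v
    simple   : IsSimple walk

open Path public

record Connected (G : Graph n) : Set where
  field
    nonempty : Nonempty (V G)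
    joined   : ∀ {u v} → u ∈ V G → v ∈ V G → ∃ λ ℓ → Walk G ℓ u v

IsPath : Graph n → Set
IsPath C = ∃₂ λ u v → Σ (Path C u v) λ P →
  (∀ {a} → a ∈ V C → OnWalk (walk P) a) ×
  (∀ {a b} → Adj C a b → Traverses (walk P) a b)

-- A spanning path with at least three vertices, closed up by one more edge vu.
IsCycle : Graph n → Set
IsCycle C = ∃₂ λ u v → Σ (Path C u v) λ P →
  2 ≤ length P × Adj C v u ×
  (∀ {a} → a ∈ V C → OnWalk (walk P) a) ×
  (∀ {a b} → Adj C a b →
    Traverses (walk P) a b ⊎ (a ≡ v × b ≡ u) ⊎ (a ≡ u × b ≡ v))

walk? : (G : Graph n) (ℓ : ℕ) → Decidable (Walk G ℓ)
walk? G zero u v with u ≟ᶠ v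
... | no u≢v   = no λ { (stop _) → u≢v refl }
... | yes refl = map′ stop (λ { (stop u∈V) → u∈V }) (u ∈? V G)
walk? G (suc ℓ) u v =
  map′ (λ (_ , e , W) → e ∷ W) (λ { (e ∷ W) → _ , e , W })
       (any? λ w → Adj? G u w ×-dec walk? G ℓ w v)

-- dist-isLeast shows that bounding the search by n loses nothing.
dist : Graph n → Fin n → Fin n → ℕ∞
dist {n} G u v = least (λ ℓ → walk? G ℓ u v) n

HasRadius≤ : Graph n → ℕ → Set
HasRadius≤ G r = ∃ λ u → u ∈ V G × (∀ v → v ∈ V G → dist G u v ≤∞ [ r ])

hasRadius≤? : (G : Graph n) → Unary.Decidable (HasRadius≤ G)
hasRadius≤? G r = any? λ u →
  (u ∈? V G) ×-dec all? (λ v → (v ∈? V G) →-dec (dist G u v ≤∞? [ r ]))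

-- rad-isLeast shows that bounding the search by n loses nothing.
rad : Graph n → ℕ∞
rad {n} G = least (hasRadius≤? G) n

-- An unordered edge, listed once by its increasing orientation.  The proofs
-- are irrelevant so that there is only one Edge per edge.
record Edge (X : Graph n) : Set where
  field
    src tgt  : Vertex X
    .adj     : Adj X (proj₁ src) (proj₁ tgt)
    .ordered : proj₁ src Fin.< proj₁ tgt

open Edge public

record IsSubdivision≥ (k : ℕ) (X : Graph m) (Y : Graph n) : Set where
  field
    branch     : Vertex X → Vertex Y
    branch-inj : Injective _≡_ _≡_ branch
    path       : (e : Edge X) → Path Y (proj₁ (branch (src e))) (proj₁ (branch (tgt e)))
    long       : ∀ e → k + 1 ≤ length (path e)
    disjoint-V : ∀ e x → ¬ Interior (walk (path e)) (proj₁ (branch x))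
    disjoint   : ∀ e e′ {a} → Interior (walk (path e)) a → Interior (walk (path e′)) a → e ≡ e′
    exhaust-V  : ∀ {a} → a ∈ V Y →
                 (∃ λ x → proj₁ (branch x) ≡ a) ⊎ (∃ λ e → Interior (walk (path e)) a)
    exhaust-E  : ∀ {a b} → Adj Y a b → ∃ λ e → Traverses (walk (path e)) a b

_IsQuasiGeodesicIn_[_] : Graph n → Graph n → (c : ℕ) .{{_ : NonZero c}} → Set
Y IsQuasiGeodesicIn G [ c ] =
  ∀ {u v} → u ∈ V Y → v ∈ V Y → dist Y u v ≤∞ c *∞ dist G u v

record Decomposition (H : Graph m) (G : Graph n) : Set where
  field
    bag : Fin m → Subset n

  -- {h : v ∈ V_h}
  bagsAt : Fin n → Subset m
  bagsAt v = tabulate λ h → does (v ∈? bag h)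

  part : Fin m → Graph n
  part h = G ↾ bag h

  coPart : Fin n → Graph m
  coPart v = H ↾ bagsAt v

  -- The inclusion ⋃ₕ G[V_h] ⊆ G always holds; covers-V and covers-E give
  -- the converse.
  field
    bag⊆V     : ∀ {h} → h ∈ V H → bag h ⊆ V G
    covers-V  : ∀ {v} → v ∈ V G → ∃ λ h → h ∈ V H × v ∈ V (part h)
    covers-E  : ∀ {u v} → Adj G u v → ∃ λ h → h ∈ V H × Adj (part h) u v
    connected : ∀ {v} → v ∈ V G → Connected (coPart v)

  IsHonest : Set
  IsHonest = (∀ {h} → h ∈ V H → Nonempty (bag h)) ×
             (∀ {h h′} → Adj H h h′ → Nonempty (bag h ∩ bag h′))

  radialWidth : ℕ∞
  radialWidth = max (V H) (λ h → rad (part h))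

  radialSpread : ℕ∞
  radialSpread = max (V G) (λ v → rad (coPart v))

open Decomposition public

record QuasiIsometric (L D : ℕ) .{{_ : NonZero L}} (A : Graph m) (B : Graph n) : Set where
  field
    φ : Vertex A → Vertex B

  dA : Vertex A → Vertex A → ℕ∞
  dA a a′ = dist A (proj₁ a) (proj₁ a′)

  dB : Vertex B → Vertex B → ℕ∞
  dB b b′ = dist B (proj₁ b) (proj₁ b′)

  field
    lower : ∀ a a′ → dA a a′ ≤∞ L *∞ dB (φ a) (φ a′) +∞ L * D
    upper : ∀ a a′ → dB (φ a) (φ a′) ≤∞ L *∞ dA a a′ +∞ D
    dense : ∀ b → ∃ λ a → dB b (φ a) ≤∞ [ D ]

private
  search : {Q : ℕ → Set} (Q? : Unary.Decidable Q) (b : ℕ) →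
           (∃ λ k → least Q? b ≡ [ k ] × Q k × (∀ {j} → Q j → k ≤ j)) ⊎
           (least Q? b ≡ ⊤⁺ × (∀ {j} → j < b → ¬ Q j))
  search Q? zero = inj₂ (refl , λ ())
  search {Q} Q? (suc b) with Q? 0
  ... | yes q₀ = inj₁ (0 , refl , q₀ , λ _ → z≤n)
  ... | no ¬q₀ with search (Q? ∘ suc) b
  ...   | inj₁ (k , eq , q , min) = inj₁
          (suc k , cong (Maybe.map suc) eq , q
          , λ { {zero} q₀ → contradiction q₀ ¬q₀ ; {suc j} qⱼ → s≤s (min qⱼ) })
  ...   | inj₂ (eq , none) = inj₂
          (cong (Maybe.map suc) eq
          , λ { {zero} _ q₀ → ¬q₀ q₀ ; {suc j} (s≤s j<b) qⱼ → none j<b qⱼ })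

least-isLeast : {P : ℕ → Set} (P? : Unary.Decidable P) (b : ℕ) →
                (∀ {j} → P j → ∃ λ i → i < b × P i) → IsLeast P (least P? b)
least-isLeast {P} P? b bounded with search P? b
... | inj₁ (k , eq , p , min) = subst (IsLeast P) (sym eq) (attained p min)
... | inj₂ (eq , none) = subst (IsLeast P) (sym eq)
        (never λ p → let (_ , i<b , pᵢ) = bounded p in none i<b pᵢ)

module _ (G : Graph n) where

  walk⇒path : ∀ {u v} → Walk G ℓ u v → Path G u v
  walk⇒path (stop u∈V) = record { walk = stop u∈V ; simple = λ { {zero} {zero} _ → refl } }
  walk⇒path {u = u} {v = v} (e ∷ W) = extend (walk⇒path W)
    where
    from : ∀ {ℓ w} (W : Walk G ℓ w v) → IsSimple W → (i : Fin (suc ℓ)) → Path G (at W i) v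
    from W       s zero    = record { walk = W ; simple = s }
    from (_ ∷ W) s (suc i) = from W (suc-injective ∘ s) i

    extend : Path G _ v → Path G u v
    extend P with any? (λ i → at (walk P) i ≟ᶠ u)
    ... | yes (i , eq) = subst (λ w → Path G w v) eq (from (walk P) (simple P) i)
    ... | no u∉P = record { walk = e ∷ walk P ; simple = λ
      { {zero}  {zero}  _  → refl
      ; {zero}  {suc j} eq → contradiction (j , sym eq) u∉P
      ; {suc i} {zero}  eq → contradiction (i , eq) u∉P
      ; {suc i} {suc j} eq → cong suc (simple P eq)
      } }

  dist-isLeast : ∀ u v → IsLeast (λ ℓ → Walk G ℓ u v) (dist G u v)
  dist-isLeast u v = least-isLeast (λ ℓ → walk? G ℓ u v) n λ W →
    let P = walk⇒path W in length P , injective⇒≤ (simple P) , walk P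

  dist<n : ∀ u v → dist G u v ≤∞ [ k ] → ∃ λ j → dist G u v ≡ [ j ] × j < n
  dist<n u v d≤k with dist G u v | dist-isLeast u v | d≤k
  ... | _ | attained W min | _ =
          let P = walk⇒path W in _ , refl , ≤-<-trans (min (walk P)) (injective⇒≤ (simple P))
  ... | _ | never _ | ()

  rad-isLeast : IsLeast (HasRadius≤ G) (rad G)
  rad-isLeast = least-isLeast (hasRadius≤? G) n λ (u , u∈V , close) →
    pred n , ≤-reflexive (suc-pred n {{nonZeroIndex u}}) , u , u∈V , λ v v∈V →
      let (j , eq , j<n) = dist<n u v (close v v∈V)
      in subst (_≤∞ [ pred n ]) (sym eq) Supremum.[ <⇒≤pred j<n ]

⊔∞-≤ : ∀ {r} x y → (x ⊔∞ y) ≤∞ r ⇔ (x ≤∞ r × y ≤∞ r)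
⊔∞-≤ {⊤⁺}    x     y     = mk⇔ (λ _ → (x Supremum.≤⊤⁺) , (y Supremum.≤⊤⁺)) (λ _ → _ Supremum.≤⊤⁺)
⊔∞-≤ {[ r ]} [ x ] [ y ] = mk⇔
  (λ { Supremum.[ p ] → Supremum.[ m⊔n≤o⇒m≤o x y p ] , Supremum.[ m⊔n≤o⇒n≤o x y p ] })
  (λ { (Supremum.[ p ] , Supremum.[ q ]) → Supremum.[ ⊔-lub p q ] })
⊔∞-≤ {[ r ]} [ x ] ⊤⁺    = mk⇔ (λ ()) (λ ())
⊔∞-≤ {[ r ]} ⊤⁺    y     = mk⇔ (λ ()) (λ ())

max-≤ : ∀ {r} (S : Subset n) (f : Fin n → ℕ∞) → max S f ≤∞ r ⇔ (∀ {i} → i ∈ S → f i ≤∞ r)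
max-≤ {r = r} S f = mk⇔ (λ le {i} i∈S → to-S i i∈S (fold→ _ le i)) (λ le → fold← _ (from-S le))
  where
  open Equivalence

  0≤∞ : ∀ r → [ 0 ] ≤∞ r
  0≤∞ ⊤⁺    = [ 0 ] Supremum.≤⊤⁺
  0≤∞ [ _ ] = Supremum.[ z≤n ]

  fold→ : ∀ {n} (g : Fin n → ℕ∞) → Vector.foldr _⊔∞_ [ 0 ] g ≤∞ r → ∀ i → g i ≤∞ r
  fold→ g le zero    = proj₁ (to (⊔∞-≤ (g zero) _) le)
  fold→ g le (suc i) = fold→ (g ∘ suc) (proj₂ (to (⊔∞-≤ (g zero) _) le)) i

  fold← : ∀ {n} (g : Fin n → ℕ∞) → (∀ i → g i ≤∞ r) → Vector.foldr _⊔∞_ [ 0 ] g ≤∞ r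
  fold← {zero}  g le = 0≤∞ r
  fold← {suc n} g le = from (⊔∞-≤ (g zero) _) (le zero , fold← (g ∘ suc) (le ∘ suc))

  to-S : ∀ i → i ∈ S → (if does (i ∈? S) then f i else [ 0 ]) ≤∞ r → f i ≤∞ r
  to-S i i∈S le with i ∈? S
  ... | yes _  = le
  ... | no i∉S = contradiction i∈S i∉S

  from-S : (∀ {i} → i ∈ S → f i ≤∞ r) → ∀ i → (if does (i ∈? S) then f i else [ 0 ]) ≤∞ r
  from-S le i with i ∈? S
  ... | yes i∈S = le i∈S
  ... | no  _   = 0≤∞ r

module Submission where

-- Let K = 3k and let P be a longest geodesic, of length m.  If all vertices lie
-- within 3K of P, then P is the core: group the Voronoi cells of P over balls of
-- radius 3K + 1 in P.  If m ≤ 6K + 2, a single vertex will do.  Otherwise some x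
-- lies further than 3K from P.  As there is no claw, a vertex further than K
-- from P has all its nearest points among the first or the last K + 1 points of
-- P.  Call a walk odd if it passes an odd number of times directly between far
-- vertices of opposite sides.  A shortest walk from x to the end of P on the
-- other side must first come near P on that other side, as it would be longer
-- than P otherwise; this yields an odd closed walk.  A shortest odd closed walk
-- is isometric, since a chord would split off a shorter odd one.  It comes near
-- P on both sides, so its length is at least 2(m - 4K) ≥ 4K + 6.  Such a cycle
-- has no vertex further than K from it, because that would give a claw.

open import Defs
open import Data.Bool.Base using (Bool; true; false; _xor_; not; _∧_; T)
open import Data.Bool.Properties
  using (∧-comm; ∧-zeroʳ; not-involutive; xor-comm; xor-assoc; xor-identityʳ; xor-same)
  renaming (_≟_ to _≟ᵇ_)
open import Data.Empty using (⊥; ⊥-elim-irr)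
open import Data.Fin.Base using (Fin; zero; suc; toℕ; fromℕ<; inject₁)
open import Data.Fin.Properties
  using (any?; all?; injective⇒≤; suc-injective; toℕ-injective; toℕ<n;
  toℕ≤pred[n]; toℕ-fromℕ; toℕ-fromℕ<; toℕ-inject₁) renaming (_≟_ to _≟ᶠ_)
open import Data.Fin.Subset using (Subset; _∈_; ⊤)
open import Data.Fin.Subset.Properties using (_∈?_; ∈⊤; x∈p∩q⁺; x∈p∩q⁻)
open import Data.List.Base using ([]) renaming (_∷_ to _◂_)
open import Data.Nat.Base
open import Data.Nat.Properties hiding (suc-injective)
open import Data.Nat.Tactic.RingSolver using (solve)
open import Data.Product.Base using (∃; ∃₂; Σ-syntax; ∃-syntax; _×_; _,_; proj₁; proj₂)
open import Data.Sum.Base using (_⊎_; inj₁; inj₂; swap)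
open import Data.Unit.Base using (tt)
open import Data.Vec.Base using (tabulate; here; there)
open import Data.Vec.Properties using (lookup∘tabulate; lookup⇒[]=; []=⇒lookup)
open import Function.Bundles using (module Equivalence)
import Relation.Binary.Construct.Add.Supremum.NonStrict as Supremum
open import Relation.Binary.PropositionalEquality
open import Relation.Nullary.Construct.Add.Supremum using (⊤⁺; [_])
open import Relation.Nullary.Decidable
  using (Dec; does; yes; no; dec-true; _×-dec_; _⊎-dec_; _→-dec_; ¬?; map′; decidable-stable)
open import Relation.Nullary.Negation using (¬_; contradiction)
import Relation.Unary as Unary

-- Linear arithmetic, minimisation, and subsets and graphs from decidable predicates.

private
  variable
    m n a b ℓ : ℕ

-- A linear inequality from a sum X ≤ Y of hypotheses: what remains is an
-- identity without subtraction, which the ring solver proves.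
lin : ∀ {X Y a b} c → X ≤ Y → b + X ≡ a + Y + c → a ≤ b
lin {X} {Y} {a} {b} c X≤Y eq = +-cancelʳ-≤ Y a b (≤-trans (m≤m+n (a + Y) c)
  (≤-trans (≤-reflexive (sym eq)) (+-monoʳ-≤ b X≤Y)))

leastNat : {P : ℕ → Set} → Unary.Decidable P → P b → ∃[ k ] P k × (∀ {j} → P j → k ≤ j)
leastNat {b = b} P? p
  with least P? (suc b) | least-isLeast P? (suc b) (λ _ → b , n<1+n b , p)
... | _ | attained q min = _ , q , min
... | _ | never none     = contradiction p none

module _ {P : Fin n → Set} (P? : Unary.Decidable P) where

  subset : Subset n
  subset = tabulate λ v → does (P? v)

  ∈-subset⁺ : ∀ {v} → P v → v ∈ subset
  ∈-subset⁺ {v} p = lookup⇒[]= v subset (trans (lookup∘tabulate _ v) (dec-true (P? v) p))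

  ∈-subset⁻ : ∀ {v} → v ∈ subset → P v
  ∈-subset⁻ {v} v∈ with P? v | trans (sym (lookup∘tabulate (λ w → does (P? w)) v)) ([]=⇒lookup v∈)
  ... | yes p | _ = p

symmetricGraph : (S : Subset n) {Link : Fin n → Fin n → Set} → (∀ u v → Dec (Link u v)) →
                 (∀ {u v} → Link u v → u ∈ S × v ∈ S × u ≢ v) → Graph n
symmetricGraph S {Link} Link? good = record
  { V = S
  ; Adj = λ u v → Link u v ⊎ Link v u
  ; Adj? = λ u v → Link? u v ⊎-dec Link? v u
  ; Adj⇒∈V = λ { (inj₁ l) → proj₁ (good l) ; (inj₂ l) → proj₁ (proj₂ (good l)) }
  ; Adj-sym = λ { (inj₁ l) → inj₂ l ; (inj₂ l) → inj₁ l }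
  ; Adj-irrefl = λ { refl (inj₁ l) → proj₂ (proj₂ (good l)) refl
                   ; refl (inj₂ l) → proj₂ (proj₂ (good l)) refl }
  }

-- Walks, distances and induced subgraphs.

module _ {G : Graph n} where

  infixr 5 _++_
  infixl 6 _!_

  source∈ : ∀ {u v} → Walk G ℓ u v → u ∈ V G
  source∈ (stop u∈) = u∈
  source∈ (e ∷ _)   = Adj⇒∈V G e

  target∈ : ∀ {u v} → Walk G ℓ u v → v ∈ V G
  target∈ (stop u∈) = u∈
  target∈ (_ ∷ W)   = target∈ W

  edge : ∀ {u v} → Adj G u v → Walk G 1 u v
  edge e = e ∷ stop (Adj⇒∈V G (Adj-sym G e))

  _++_ : ∀ {u v w} → Walk G a u v → Walk G b v w → Walk G (a + b) u w
  stop _  ++ X = X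
  (e ∷ W) ++ X = e ∷ (W ++ X)

  reverse : ∀ {u v} → Walk G ℓ u v → Walk G ℓ v u
  reverse (stop u∈)           = stop u∈
  reverse {ℓ = suc ℓ} {u} {v} (e ∷ W) =
    subst (λ l → Walk G l v u) (+-comm ℓ 1) (reverse W ++ edge (Adj-sym G e))

  -- Positions beyond the end of the walk all denote its last vertex.
  _!_ : ∀ {u v} → Walk G ℓ u v → ℕ → Fin n
  _!_ {u = u} (stop _)  _       = u
  _!_ {u = u} (_ ∷ _)   zero    = u
  (_ ∷ W)             ! (suc t) = W ! t

  !-start : ∀ {u v} (W : Walk G ℓ u v) → W ! 0 ≡ u
  !-start (stop _) = refl
  !-start (_ ∷ _)  = refl

  !-end : ∀ {u v} (W : Walk G ℓ u v) → W ! ℓ ≡ v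
  !-end (stop _) = refl
  !-end (_ ∷ W)  = !-end W

  !-step : ∀ {u v} (W : Walk G ℓ u v) {t} → t < ℓ → Adj G (W ! t) (W ! suc t)
  !-step (e ∷ W) {zero}  _         = subst (Adj G _) (sym (!-start W)) e
  !-step (_ ∷ W) {suc t} (s≤s t<ℓ) = !-step W t<ℓ

  take : ∀ a {u v} (W : Walk G (a + b) u v) → Walk G a u (W ! a)
  take zero    (stop u∈) = stop u∈
  take zero    (e ∷ _)   = stop (Adj⇒∈V G e)
  take (suc a) (e ∷ W) = e ∷ take a W

  drop : ∀ a {u v} (W : Walk G (a + b) u v) → Walk G b (W ! a) v
  drop zero    (stop u∈) = stop u∈
  drop zero    (e ∷ W)   = e ∷ W
  drop (suc a) (_ ∷ W) = drop a W

  follow : (p : ℕ → Fin n) (ℓ : ℕ) → (∀ {t} → t < ℓ → Adj G (p t) (p (suc t))) →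
           p ℓ ∈ V G → ∀ {u v} → p 0 ≡ u → p ℓ ≡ v → Walk G ℓ u v
  follow p zero    step end refl refl = stop end
  follow p (suc ℓ) step end refl eq   =
    step z<s ∷ follow (λ t → p (suc t)) ℓ (λ t<ℓ → step (s<s t<ℓ)) end refl eq

  at-follow : ∀ p ℓ (step : ∀ {t} → t < ℓ → Adj G (p t) (p (suc t))) end
              {u v} (p₀ : p 0 ≡ u) (pₗ : p ℓ ≡ v) i →
              at (follow p ℓ step end p₀ pₗ) i ≡ p (toℕ i)
  at-follow p zero    step end refl refl zero    = refl
  at-follow p (suc ℓ) step end refl eq   zero    = refl
  at-follow p (suc ℓ) step end refl eq   (suc i) =
    at-follow (λ t → p (suc t)) ℓ (λ t<ℓ → step (s<s t<ℓ)) end refl eq i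

  segment : (p : ℕ → Fin n) (i d : ℕ) → (∀ {t} → t < i + d → Adj G (p t) (p (suc t))) →
            p (i + d) ∈ V G → Walk G d (p i) (p (i + d))
  segment p zero    d step end = follow p d step end refl refl
  segment p (suc i) d step end = segment (λ t → p (suc t)) i d (λ t< → step (s<s t<)) end

  -- Membership in balls and in Voronoi cells is decided by the lengths of the two pieces into which
  -- a vertex cuts the walk, so the hypothesis supplies both pieces.
  restrict : ∀ {S u v} (W : Walk G ℓ u v) →
             (∀ {w a b} → a + b ≡ ℓ → Walk G a u w → Walk G b w v → w ∈ S) →
             Walk (G ↾ S) ℓ u v
  restrict (stop u∈) on = stop (x∈p∩q⁺ (u∈ , on refl (stop u∈) (stop u∈)))
  restrict (e ∷ W)   on =
    (e , on refl (stop (Adj⇒∈V G e)) (e ∷ W) , on refl (edge e) W) ∷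
    restrict W λ eq X → on (cong suc eq) (e ∷ X)

Within : Graph n → ℕ → Fin n → Fin n → Set
Within G r u v = ∃[ ℓ ] ℓ ≤ r × Walk G ℓ u v

module _ (G : Graph n) where

  dist≤ : ∀ {r u v} → Within G r u v → dist G u v ≤∞ [ r ]
  dist≤ {u = u} {v} (_ , ℓ≤r , W) with dist G u v | dist-isLeast G u v
  ... | _ | attained _ min = Supremum.[ ≤-trans (min W) ℓ≤r ]
  ... | _ | never none     = contradiction W none

  dist≤⁻¹ : ∀ {r u v} → dist G u v ≤∞ [ r ] → Within G r u v
  dist≤⁻¹ {u = u} {v} d≤r with dist G u v | dist-isLeast G u v | d≤r
  ... | _ | attained W _ | Supremum.[ k≤r ] = _ , k≤r , W

  within? : ∀ r u v → Dec (Within G r u v)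
  within? r u v = map′ dist≤⁻¹ dist≤ (dist G u v ≤∞? [ r ])

  rad≤ : ∀ {r} → HasRadius≤ G r → rad G ≤∞ [ r ]
  rad≤ h with rad G | rad-isLeast G
  ... | _ | attained _ min = Supremum.[ min h ]
  ... | _ | never none     = contradiction h none

-- `F` extends `f` to infinite distances; without a walk in `G` the bound is infinite. The
-- quasi-geodesic and the quasi-isometry inequalities both have this shape.
dist-compare : (G : Graph m) (H : Graph n) (F : ℕ∞ → ℕ∞) {f : ℕ → ℕ} →
               (∀ ℓ → F [ ℓ ] ≡ [ f ℓ ]) → F ⊤⁺ ≡ ⊤⁺ →
               ∀ {u v u′ v′} → (∀ {ℓ} → Walk G ℓ u v → Within H (f ℓ) u′ v′) →
               dist H u′ v′ ≤∞ F (dist G u v)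
dist-compare G H F fin inf {u} {v} {u′} {v′} shorten with dist G u v | dist-isLeast G u v
... | _ | attained {k = k} W _ = subst (dist H u′ v′ ≤∞_) (sym (fin k)) (dist≤ H (shorten W))
... | _ | never _ = subst (dist H u′ v′ ≤∞_) (sym inf) (_ Supremum.≤⊤⁺)

-- Voronoi cells and the decomposition along an isometric subgraph

mapWalk : {G : Graph m} {H : Graph n} (f : Fin m → Fin n) →
          (∀ {u} → u ∈ V G → f u ∈ V H) → (∀ {u v} → Adj G u v → Adj H (f u) (f v)) →
          ∀ {u v} → Walk G ℓ u v → Walk H ℓ (f u) (f v)
mapWalk f f∈ hom (stop u∈) = stop (f∈ u∈)
mapWalk f f∈ hom (e ∷ W)   = hom e ∷ mapWalk f f∈ hom W

within-reverse : {G : Graph n} {r : ℕ} → ∀ {u v} → Within G r u v → Within G r v u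
within-reverse (ℓ , ℓ≤r , W) = ℓ , ℓ≤r , reverse W

within-0 : {G : Graph n} → ∀ {u v} → Within G 0 u v → u ≡ v
within-0 (_ , z≤n , stop _) = refl

-- Serves to put both ends of an edge into one bag: their projections are at most 2r + 1 apart, and
-- the bags come from balls of radius r + 1.
within-midpoint : (G : Graph n) (r : ℕ) → ∀ {u v} → Within G (suc r + r) u v →
                  ∃[ w ] Within G (suc r) u w × Within G (suc r) v w
within-midpoint G r {u} {v} (ℓ , ℓ≤ , W) with ℓ ≤? suc r
... | yes ℓ≤r = v , (ℓ , ℓ≤r , W) , (0 , z≤n , stop (target∈ W))
... | no  ℓ≰r with m≤n⇒∃[o]m+o≡n (<⇒≤ (≰⇒> ℓ≰r))
...   | d , refl = _ , (suc r , ≤-refl , take (suc r) W)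
                     , (d , m≤n⇒m≤1+n (+-cancelˡ-≤ (suc r) d r ℓ≤) , reverse (drop (suc r) W))

module Voronoi (G : Graph n) (conn : Connected G) (φ : Fin (suc m) → Fin n)
               (φ∈ : ∀ i → φ i ∈ V G) where

  nearest : ∀ {v} → v ∈ V G → ∃₂ λ h i → Walk G h v (φ i) ×
            (∀ {ℓ j} → Walk G ℓ v (φ j) → h ≤ ℓ) × (∀ {j} → Walk G h v (φ j) → toℕ i ≤ toℕ j)
  nearest {v} v∈
    with leastNat (λ ℓ → any? λ i → walk? G ℓ v (φ i)) (zero , proj₂ (Connected.joined conn v∈ (φ∈ zero)))
  ... | h , (j , W) , min
    with leastNat (λ k → any? λ i → (toℕ i ≟ k) ×-dec walk? G h v (φ i)) (j , refl , W)
  ...   | _ , (i , refl , X) , min′ =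
          h , i , X , (λ Z → min (_ , Z)) , (λ Z → min′ (_ , refl , Z))

  -- Outside `G` the value 0 is a placeholder; the lemmas on heights have a walk or a proof of
  -- membership that rules this case out.
  height : Fin n → ℕ
  height v with v ∈? V G
  ... | yes v∈ = proj₁ (nearest v∈)
  ... | no  _  = 0

  -- Ties are broken towards the least index, so that proj is constant along
  -- every shortest walk from v to φ (proj v).
  proj : Fin n → Fin (suc m)
  proj v with v ∈? V G
  ... | yes v∈ = proj₁ (proj₂ (nearest v∈))
  ... | no  _  = zero

  descent : ∀ {v} → v ∈ V G → Walk G (height v) v (φ (proj v))
  descent {v} v∈ with v ∈? V G
  ... | yes v∈′ = proj₁ (proj₂ (proj₂ (nearest v∈′)))
  ... | no  v∉  = contradiction v∈ v∉

  height-min : ∀ {v j} → Walk G ℓ v (φ j) → height v ≤ ℓ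
  height-min {v = v} W with v ∈? V G
  ... | yes v∈ = proj₁ (proj₂ (proj₂ (proj₂ (nearest v∈)))) W
  ... | no  v∉ = contradiction (source∈ W) v∉

  proj-min : ∀ {v j} → Walk G (height v) v (φ j) → toℕ (proj v) ≤ toℕ j
  proj-min {v = v} W with v ∈? V G
  ... | yes v∈ = proj₂ (proj₂ (proj₂ (proj₂ (nearest v∈)))) W
  ... | no  v∉ = contradiction (source∈ W) v∉

  height-step : ∀ {u v} → Walk G ℓ u v → height u ≤ ℓ + height v
  height-step W = height-min (W ++ descent (target∈ W))

  -- A nearest point of `w` is also a nearest point of `v`, being reached through `w`, and
  -- `φ (proj v)` is nearest to `w`. So the least index is the same for both.
  proj-descent : ∀ {v w} → a + b ≡ height v → Walk G a v w → Walk G b w (φ (proj v)) → proj w ≡ proj v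
  proj-descent {a} {b} {v} {w} eq X Y = toℕ-injective (≤-antisym
    (proj-min (subst (λ l → Walk G l w (φ (proj v))) b≡h Y))
    (proj-min (subst (λ l → Walk G l v (φ (proj w))) (trans (cong (a +_) (sym b≡h)) eq)
                     (X ++ descent (target∈ X)))))
    where
    b≡h : b ≡ height w
    b≡h = ≤-antisym
      (+-cancelˡ-≤ a b (height w) (≤-trans (≤-reflexive eq) (height-step X)))
      (height-min Y)

  -- Otherwise `W` could replace the last t steps of `Q`, and `y` would reach the core in fewer than
  -- `height y` steps.
  ascent : ∀ {y t j} {i : Fin n} (Q : Walk G (height y) y i) → t ≤ height y →
           Walk G ℓ (reverse Q ! t) (φ j) → t ≤ ℓ
  ascent {ℓ = ℓ} {y} {t} {i = i} Q t≤h W with m≤n⇒∃[o]m+o≡n t≤h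
  ... | e , eq = +-cancelʳ-≤ e t ℓ (begin
    t + e    ≡⟨ eq ⟩
    height y ≤⟨ height-min (remaining eq (reverse Q) ++ W) ⟩
    e + ℓ    ≡⟨ +-comm e ℓ ⟩
    ℓ + e    ∎)
    where
    open ≤-Reasoning
    remaining : ∀ {h} → t + e ≡ h → (R : Walk G h i y) → Walk G e y (R ! t)
    remaining refl R = reverse (drop t R)

-- The bags are unions of Voronoi cells of φ over the balls of radius a in C.
module IsometricCore
  (G : Graph n) (conn : Connected G) (C : Graph (suc m)) (C∈ : ∀ i → i ∈ V C)
  (φ : Fin (suc m) → Fin n) (φ∈ : ∀ i → φ i ∈ V G)
  (hom : ∀ {i j} → Adj C i j → Adj G (φ i) (φ j))
  (isometric : ∀ {ℓ i j} → Walk G ℓ (φ i) (φ j) → Within C ℓ i j)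
  where

  open Voronoi G conn φ φ∈ public
  open Equivalence using (from)

  embed : ∀ {i j} → Walk C ℓ i j → Walk G ℓ (φ i) (φ j)
  embed = mapWalk φ (λ _ → φ∈ _) hom

  -- The descent from `φ i` has length 0, and `isometric` turns a walk of length 0 into equality of
  -- indices.
  proj-φ : ∀ i → proj (φ i) ≡ i
  proj-φ i = sym (within-0 (isometric (subst (λ l → Walk G l (φ i) (φ (proj (φ i))))
    (n≤0⇒n≡0 (height-min (stop (φ∈ i)))) (descent (φ∈ i)))))

  module _ (r a : ℕ) (dense : ∀ {v} → v ∈ V G → height v ≤ r)
    (midpoint : ∀ {i j} → Within C (suc r + r) i j → ∃[ l ] Within C a i l × Within C a j l)
    where

    InBag : Fin (suc m) → Fin n → Set
    InBag j v = v ∈ V G × Within C a j (proj v)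

    inBag? : ∀ j v → Dec (InBag j v)
    inBag? j v = (v ∈? V G) ×-dec within? C a j (proj v)

    bagOf : Fin (suc m) → Subset n
    bagOf j = subset (inBag? j)

    stay : ∀ j → Within C a j j
    stay j = 0 , z≤n , stop (C∈ j)

    φ∈bag : ∀ {i j} → Within C a j i → φ i ∈ bagOf j
    φ∈bag {i} {j} w = ∈-subset⁺ (inBag? j) (φ∈ i , subst (Within C a j) (sym (proj-φ i)) w)

    -- Descend from u, cross the edge and descend from v: at most r + 1 + r steps, which is the
    -- distance that `midpoint` can halve.
    projections-close : ∀ {u v} → Adj G u v → Within C (suc r + r) (proj u) (proj v)
    projections-close {u} {v} e =
      let (ℓ , ℓ≤ , X) = isometric (reverse (descent u∈) ++ (e ∷ descent v∈))
      in ℓ , ≤-trans ℓ≤ (lin 0 (+-mono-≤ (dense u∈) (dense v∈)) (id-eq (height u) (height v))) , X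
      where
      u∈ = Adj⇒∈V G e
      v∈ = Adj⇒∈V G (Adj-sym G e)
      id-eq : ∀ x y → suc r + r + (x + y) ≡ x + suc y + (r + r) + 0
      id-eq x y = solve (r ◂ x ◂ y ◂ [])

    inBagOf? : ∀ v h → Dec (v ∈ bagOf h)
    inBagOf? v h = v ∈? bagOf h

    centre∈ : ∀ {v} → v ∈ V G → proj v ∈ subset (inBagOf? v)
    centre∈ {v} v∈ = ∈-subset⁺ (inBagOf? v) (∈-subset⁺ (inBag? _) (v∈ , stay _))

    -- The bags containing v form the ball of radius a about `proj v`, and a walk of length at most
    -- a to the centre of a ball never leaves it. This gives both the connectedness of `coPart` and
    -- the spread.
    toCentre : ∀ {v i} → v ∈ V G → i ∈ V (C ↾ subset (inBagOf? v)) →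
               Within (C ↾ subset (inBagOf? v)) a i (proj v)
    toCentre {v} {i} v∈ i∈ =
      let (_ , i∈′) = x∈p∩q⁻ (V C) (subset (inBagOf? v)) i∈
          (_ , ℓ , ℓ≤a , X) = ∈-subset⁻ (inBag? i) (∈-subset⁻ (inBagOf? v) i∈′)
      in ℓ , ℓ≤a , restrict X λ {w} {b} {c} eq _ Y → ∈-subset⁺ (inBagOf? v) (∈-subset⁺ (inBag? w)
           (v∈ , c , ≤-trans (≤-trans (m≤n+m c b) (≤-reflexive eq)) ℓ≤a , Y))

    decomposition : Decomposition C G
    decomposition = record
      { bag = bagOf
      ; bag⊆V = λ {j} _ v∈ → proj₁ (∈-subset⁻ (inBag? j) v∈)
      ; covers-V = λ {v} v∈ → proj v , C∈ _ ,
          x∈p∩q⁺ (v∈ , ∈-subset⁺ (inBag? (proj v)) (v∈ , stay _))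
      ; covers-E = λ {u} {v} e →
          let (l , wᵤ , wᵥ) = midpoint (projections-close e)
          in l , C∈ l , e
             , ∈-subset⁺ (inBag? l) (Adj⇒∈V G e , within-reverse wᵤ)
             , ∈-subset⁺ (inBag? l) (Adj⇒∈V G (Adj-sym G e) , within-reverse wᵥ)
      ; connected = λ {v} v∈ → record
          { nonempty = proj v , x∈p∩q⁺ (C∈ _ , centre∈ v∈)
          ; joined = λ i∈ j∈ → _ , proj₂ (proj₂ (toCentre v∈ i∈)) ++ reverse (proj₂ (proj₂ (toCentre v∈ j∈)))
          }
      }

    -- The two parts of a walk from φ j via φ (proj v) to v: along C and inside the cell of v.
    part-radius : ∀ j → HasRadius≤ (part decomposition j) (a + r)
    part-radius j = φ j , φj∈ , λ v v∈ → dist≤ (part decomposition j) (fromCentre v∈)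
      where
      φj∈ = x∈p∩q⁺ (φ∈ j , φ∈bag (stay j))
      ball? = within? C a j
      ball : Subset (suc m)
      ball = subset ball?
      hom′ : ∀ {i l} → Adj (C ↾ ball) i l → Adj (part decomposition j) (φ i) (φ l)
      hom′ (e , i∈ , l∈) = hom e , φ∈bag (∈-subset⁻ ball? i∈) , φ∈bag (∈-subset⁻ ball? l∈)
      fromCentre : ∀ {v} → v ∈ V (part decomposition j) → Within (part decomposition j) (a + r) (φ j) v
      fromCentre {v} v∈ =
        let (v∈G , v∈bag) = x∈p∩q⁻ (V G) (bagOf j) v∈
            (_ , ℓ , ℓ≤a , X) = ∈-subset⁻ (inBag? j) v∈bag
            X′ = restrict X λ {w} {b} {c} eq Y _ → ∈-subset⁺ ball?
                   (b , ≤-trans (≤-trans (m≤m+n b c) (≤-reflexive eq)) ℓ≤a , Y)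
            Z = restrict {S = bagOf j} (descent v∈G) λ {w} {b} {c} eq Y Y′ → ∈-subset⁺ (inBag? j)
                  (target∈ Y , ℓ , ℓ≤a , subst (Walk C ℓ j) (sym (proj-descent eq Y Y′)) X)
        in _ , +-mono-≤ ℓ≤a (dense v∈G) ,
           mapWalk φ (λ {i} i∈ → x∈p∩q⁺ (φ∈ i , φ∈bag (∈-subset⁻ ball? (proj₂ (x∈p∩q⁻ (V C) ball i∈))))) hom′ X′ ++ reverse Z

    coPart-radius : ∀ {v} → v ∈ V G → HasRadius≤ (coPart decomposition v) a
    coPart-radius {v} v∈ = proj v , x∈p∩q⁺ (C∈ _ , centre∈ v∈) , λ i i∈ →
      dist≤ (coPart decomposition v) (within-reverse (toCentre v∈ i∈))

    -- The ends of an edge of `C` have distance 1, which is within the reach of `midpoint`; the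
    -- image of the midpoint lies in both bags.
    honest : IsHonest decomposition
    honest = (λ {j} _ → φ j , φ∈bag (stay j)) , λ {i} {j} e →
      let (l , wᵢ , wⱼ) = midpoint (1 , s≤s z≤n , edge e)
      in φ l , x∈p∩q⁺ (φ∈bag wᵢ , φ∈bag wⱼ)

    radialWidth≤ : radialWidth decomposition ≤∞ [ a + r ]
    radialWidth≤ = from (max-≤ (V C) _) λ {j} _ → rad≤ (part decomposition j) (part-radius j)

    radialSpread≤ : radialSpread decomposition ≤∞ [ a ]
    radialSpread≤ = from (max-≤ (V G) _) λ {v} v∈ → rad≤ (coPart decomposition v) (coPart-radius v∈)

  -- The embedding `φ` preserves distances exactly, and D bounds the distance of a vertex from the
  -- core.
  quasiIsometric : (D : ℕ) → (∀ {v} → v ∈ V G → height v ≤ D) → QuasiIsometric 1 D C G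
  quasiIsometric D dense = record
    { φ = λ (i , _) → φ i , φ∈ i
    ; lower = λ _ _ → dist-compare G C (λ x → 1 *∞ x +∞ 1 * D) (λ _ → refl) refl λ X →
        let (ℓ , ℓ≤ , Y) = isometric X in ℓ , ≤-trans ℓ≤ (slack _ _) , Y
    ; upper = λ _ _ → dist-compare C G (λ x → 1 *∞ x +∞ D) (λ _ → refl) refl λ X →
        _ , slack _ _ , embed X
    ; dense = λ (v , v∈) → (proj v , C∈ _) , dist≤ G (_ , dense v∈ , descent v∈)
    }
    where
    slack : ∀ x d → x ≤ 1 * x + d
    slack x d = ≤-trans (≤-reflexive (sym (*-identityˡ x))) (m≤m+n (1 * x) d)

-- Paths and cycles

-- Arguments above m go to m. Being total on ℕ, it turns positions into vertices in the form that
-- `follow` and `segment` expect.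
clamp : ∀ m → ℕ → Fin (suc m)
clamp zero    _       = zero
clamp (suc m) zero    = zero
clamp (suc m) (suc t) = suc (clamp m t)

toℕ-clamp : ∀ {m t} → t ≤ m → toℕ (clamp m t) ≡ t
toℕ-clamp {zero}  z≤n       = refl
toℕ-clamp {suc m} z≤n       = refl
toℕ-clamp {suc m} (s≤s t≤m) = cong suc (toℕ-clamp t≤m)

clamp-toℕ : (i : Fin (suc m)) → clamp m (toℕ i) ≡ i
clamp-toℕ i = toℕ-injective (toℕ-clamp (toℕ≤pred[n] i))

-- What `pathGraph` and `cycleGraph` share: the spanning path 0, 1, ..., m.
module Spanned (C : Graph (suc m)) (C∈ : ∀ i → i ∈ V C)
               (step : ∀ {i j} → toℕ j ≡ suc (toℕ i) → Adj C i j) where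

  clamp-step : ∀ {t} → t < m → Adj C (clamp m t) (clamp m (suc t))
  clamp-step t<m = step (trans (toℕ-clamp t<m) (cong suc (sym (toℕ-clamp (<⇒≤ t<m)))))

  line : Walk C m (clamp m 0) (clamp m m)
  line = follow (clamp m) m clamp-step (C∈ _) refl refl

  at-line : ∀ i → at line i ≡ i
  at-line i = trans (at-follow (clamp m) m clamp-step (C∈ _) refl refl i) (clamp-toℕ i)

  linePath : Path C (clamp m 0) (clamp m m)
  linePath = record { walk = line ; simple = λ {i} {j} eq → trans (sym (at-line i)) (trans eq (at-line j)) }

  line-traverses : ∀ {i j} → toℕ j ≡ suc (toℕ i) → Traverses line i j
  line-traverses {i} {j} eq = x , inj₁
    ( trans (at-line (inject₁ x)) (toℕ-injective (trans (toℕ-inject₁ x) x≡i))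
    , trans (at-line (suc x)) (toℕ-injective (trans (cong suc x≡i) (sym eq))))
    where
    i<m : toℕ i < m
    i<m = ≤-trans (≤-reflexive (sym eq)) (toℕ≤pred[n] j)
    x = fromℕ< i<m
    x≡i : toℕ x ≡ toℕ i
    x≡i = toℕ-fromℕ< i<m

  forward : ∀ {i j d} → toℕ i + d ≡ toℕ j → Walk C d i j
  forward {i} {j} {d} eq = subst₂ (Walk C d) (clamp-toℕ i) (trans (cong (clamp m) eq) (clamp-toℕ j))
    (segment (clamp m) (toℕ i) d
      (λ t< → clamp-step (<-≤-trans t< (≤-trans (≤-reflexive eq) (toℕ≤pred[n] j)))) (C∈ _))

consecutive : Fin n → Fin n → Set
consecutive i j = toℕ j ≡ suc (toℕ i)

consecutive⇒≢ : ∀ {i j : Fin n} → consecutive i j → i ≢ j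
consecutive⇒≢ eq refl = m≢1+n+m _ {0} eq

pathGraph : ∀ m → Graph (suc m)
pathGraph m = symmetricGraph ⊤ {consecutive} (λ i j → toℕ j ≟ suc (toℕ i))
  (λ l → ∈⊤ , ∈⊤ , consecutive⇒≢ l)

reverse-traverses : {G : Graph n} → ∀ {u v a b} {W : Walk G ℓ u v} → Traverses W a b → Traverses W b a
reverse-traverses (i , inj₁ p) = i , inj₂ p
reverse-traverses (i , inj₂ p) = i , inj₁ p

pathGraph-isPath : ∀ m → IsPath (pathGraph m)
pathGraph-isPath m = _ , _ , linePath , (λ {a} _ → a , at-line a) ,
  λ { (inj₁ l) → line-traverses l ; (inj₂ l) → reverse-traverses {W = line} (line-traverses l) }
  where open Spanned (pathGraph m) (λ _ → ∈⊤) inj₁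

closing : Fin (suc m) → Fin (suc m) → Set
closing {m} i j = toℕ i ≡ m × toℕ j ≡ 0

cycleGraph : ∀ m → 0 < m → Graph (suc m)
cycleGraph m 0<m = symmetricGraph ⊤ {λ i j → consecutive i j ⊎ closing i j}
  (λ i j → (toℕ j ≟ suc (toℕ i)) ⊎-dec ((toℕ i ≟ m) ×-dec (toℕ j ≟ 0)))
  (λ l → ∈⊤ , ∈⊤ , distinct l)
  where
  distinct : ∀ {i j : Fin (suc m)} → consecutive i j ⊎ closing i j → i ≢ j
  distinct (inj₁ l)        eq   = consecutive⇒≢ l eq
  distinct (inj₂ (p , q)) refl = <⇒≢ 0<m (trans (sym q) p)

cycleGraph-isCycle : ∀ m (0<m : 0 < m) → 2 ≤ m → IsCycle (cycleGraph m 0<m)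
cycleGraph-isCycle m 0<m 2≤m = _ , _ , linePath , 2≤m ,
  inj₁ (inj₂ (toℕ-clamp ≤-refl , toℕ-clamp z≤n)) , (λ {a} _ → a , at-line a) ,
  λ { (inj₁ (inj₁ l)) → inj₁ (line-traverses l)
    ; (inj₂ (inj₁ l)) → inj₁ (reverse-traverses {W = line} (line-traverses l))
    ; (inj₁ (inj₂ (p , q))) → inj₂ (inj₁ (is p ≤-refl , is q z≤n))
    ; (inj₂ (inj₂ (p , q))) → inj₂ (inj₂ (is q z≤n , is p ≤-refl)) }
  where
  open Spanned (cycleGraph m 0<m) (λ _ → ∈⊤) (λ l → inj₁ (inj₁ l))
  is : ∀ {i : Fin (suc m)} {t} → toℕ i ≡ t → t ≤ m → i ≡ clamp m t
  is eq t≤m = toℕ-injective (trans eq (sym (toℕ-clamp t≤m)))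

module _ {G : Graph n} {φ : Fin (suc m) → Fin n} where

  isometric-wlog : {C : Graph (suc m)} →
    (∀ {ℓ i j d} → toℕ i + d ≡ toℕ j → Walk G ℓ (φ i) (φ j) → Within C ℓ i j) →
    ∀ {ℓ i j} → Walk G ℓ (φ i) (φ j) → Within C ℓ i j
  isometric-wlog ascending {i = i} {j} W with ≤-total (toℕ i) (toℕ j)
  ... | inj₁ i≤j = ascending (proj₂ (m≤n⇒∃[o]m+o≡n i≤j)) W
  ... | inj₂ j≤i = within-reverse (ascending (proj₂ (m≤n⇒∃[o]m+o≡n j≤i)) (reverse W))

  pathGraph-isometric : (∀ {ℓ i j d} → toℕ i + d ≡ toℕ j → Walk G ℓ (φ i) (φ j) → d ≤ ℓ) →
                        ∀ {ℓ i j} → Walk G ℓ (φ i) (φ j) → Within (pathGraph m) ℓ i j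
  pathGraph-isometric geodesic = isometric-wlog λ eq W → _ , geodesic eq W , forward eq
    where open Spanned (pathGraph m) (λ _ → ∈⊤) inj₁

  -- The two arcs between i and j have lengths d and m + 1 - d. The hypothesis says that one of them
  -- is at most ℓ, and that arc is the required walk.
  cycleGraph-isometric : (0<m : 0 < m) →
    (∀ {ℓ i j d} → toℕ i + d ≡ toℕ j → Walk G ℓ (φ i) (φ j) → d ≤ ℓ ⊎ suc m ≤ d + ℓ) →
    ∀ {ℓ i j} → Walk G ℓ (φ i) (φ j) → Within (cycleGraph m 0<m) ℓ i j
  cycleGraph-isometric 0<m geodesic = isometric-wlog ascending
    where
    open Spanned (cycleGraph m 0<m) (λ _ → ∈⊤) (λ l → inj₁ (inj₁ l))

    arith : ∀ i d e ℓ → suc (i + d + e) ≤ d + ℓ → i + suc e ≤ ℓ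
    arith i d e ℓ h = lin 0 h (solve (i ◂ d ◂ e ◂ ℓ ◂ []))

    ascending : ∀ {ℓ i j d} → toℕ i + d ≡ toℕ j → Walk G ℓ (φ i) (φ j) →
                Within (cycleGraph m 0<m) ℓ i j
    ascending {ℓ} {i} {j} {d} eq W with geodesic eq W
    ... | inj₁ d≤ℓ   = d , d≤ℓ , forward eq
    -- Down from i to 0, across the closing edge to m, and down to j, where e = m - j.
    ... | inj₂ m<d+ℓ = toℕ i + suc e
        , arith (toℕ i) d e ℓ (subst (λ x → suc x ≤ d + ℓ) (sym (trans (cong (_+ e) eq) eq′)) m<d+ℓ)
        , reverse (forward {clamp m 0} (cong (_+ toℕ i) (toℕ-clamp {m} z≤n)))
            ++ inj₂ (inj₂ (toℕ-clamp {m} ≤-refl , toℕ-clamp {m} z≤n))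
            ∷ reverse (forward (trans eq′ (sym (toℕ-clamp {m} ≤-refl))))
      where
      e = proj₁ (m≤n⇒∃[o]m+o≡n (toℕ≤pred[n] j))
      eq′ : toℕ j + e ≡ m
      eq′ = proj₂ (m≤n⇒∃[o]m+o≡n (toℕ≤pred[n] j))

-- Subdivided claws

∈-irrelevant : ∀ {S : Subset n} {v} (p q : v ∈ S) → p ≡ q
∈-irrelevant here      here      = refl
∈-irrelevant (there p) (there q) = cong there (∈-irrelevant p q)

vertex-≡ : {G : Graph n} {u v : Vertex G} → proj₁ u ≡ proj₁ v → u ≡ v
vertex-≡ {u = u , p} {v = _ , q} refl = cong (u ,_) (∈-irrelevant p q)

spoke : Fin 3 → Edge K₁,₃
spoke j = record { src = zero , ∈⊤ ; tgt = suc j , ∈⊤ ; adj = inj₁ (refl , λ ()) ; ordered = z<s }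

edge-≡ : {X : Graph n} {e e′ : Edge X} → proj₁ (src e) ≡ proj₁ (src e′) → proj₁ (tgt e) ≡ proj₁ (tgt e′) → e ≡ e′
edge-≡ {X = X} {e} {e′} p q with vertex-≡ {G = X} {src e} {src e′} p | vertex-≡ {G = X} {tgt e} {tgt e′} q
... | refl | refl = refl

leaves-independent : ∀ {i j : Fin 3} → ¬ Adj K₁,₃ (suc i) (suc j)
leaves-independent (inj₁ (() , _))
leaves-independent (inj₂ (_ , ()))

-- `f j t` is the vertex t steps from the centre on leg j. By `diff` the way through the centre is
-- at most 3 times as long as any other; for ℓ = 0 this also makes the legs disjoint outside the
-- centre.
module Claw
  (G : Graph n) (s : ℕ) (0<s : 0 < s) (f : Fin 3 → ℕ → Fin n)
  (f₀ : ∀ j → f zero 0 ≡ f j 0)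
  (step : ∀ j {t} → t < s → Adj G (f j t) (f j (suc t)))
  (same : ∀ j {t d ℓ} → t + d ≤ s → Walk G ℓ (f j t) (f j (t + d)) → d ≤ ℓ)
  (diff : ∀ {j j′ t t′ ℓ} → j ≢ j′ → t ≤ s → t′ ≤ s → Walk G ℓ (f j t) (f j′ t′) → t + t′ ≤ 3 * ℓ)
  where

  f∈ : ∀ j {t} → t ≤ s → f j t ∈ V G
  f∈ j {zero}  _   = Adj⇒∈V G (step j 0<s)
  f∈ j {suc t} t<s = Adj⇒∈V G (Adj-sym G (step j t<s))

  same-injective : ∀ j {t t′} → t ≤ t′ → t′ ≤ s → f j t ≡ f j t′ → t ≡ t′
  same-injective j {t} t≤t′ t′≤s eq with m≤n⇒∃[o]m+o≡n t≤t′
  ... | d , refl = sym (trans (cong (t +_) (n≤0⇒n≡0 (same j t′≤s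
        (subst (Walk G 0 (f j t)) eq (stop (f∈ j (≤-trans t≤t′ t′≤s))))))) (+-identityʳ t))

  f-injective : ∀ {j j′ t t′} → t ≤ s → t′ ≤ s → f j t ≡ f j′ t′ → (j ≡ j′ × t ≡ t′) ⊎ (t ≡ 0 × t′ ≡ 0)
  f-injective {j} {j′} {t} {t′} t≤ t′≤ eq with j ≟ᶠ j′ | ≤-total t t′
  ... | yes refl | inj₁ t≤t′ = inj₁ (refl , same-injective j t≤t′ t′≤ eq)
  ... | yes refl | inj₂ t′≤t = inj₁ (refl , sym (same-injective j t′≤t t≤ (sym eq)))
  ... | no j≢j′  | _ =
    let z = n≤0⇒n≡0 (diff j≢j′ t≤ t′≤ (subst (Walk G 0 (f j t)) eq (stop (f∈ j t≤))))
    in inj₂ (m+n≡0⇒m≡0 t z , m+n≡0⇒n≡0 t z)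

  OnLeg : Fin n → Set
  OnLeg v = ∃[ j ] Σ[ t ∈ Fin (suc s) ] f j (toℕ t) ≡ v

  onLeg? : ∀ v → Dec (OnLeg v)
  onLeg? v = any? λ j → any? λ t → f j (toℕ t) ≟ᶠ v

  Link : Fin n → Fin n → Set
  Link u v = ∃[ j ] Σ[ t ∈ Fin s ] (f j (toℕ t) ≡ u × f j (suc (toℕ t)) ≡ v)

  link? : ∀ u v → Dec (Link u v)
  link? u v = any? λ j → any? λ t → (f j (toℕ t) ≟ᶠ u) ×-dec (f j (suc (toℕ t)) ≟ᶠ v)

  link⇒Adj : ∀ {u v} → Link u v → Adj G u v
  link⇒Adj (j , t , refl , refl) = step j (toℕ<n t)

  onLeg : ∀ j {t} → t ≤ s → OnLeg (f j t)
  onLeg j t≤s = j , fromℕ< (s≤s t≤s) , cong (f j) (toℕ-fromℕ< (s≤s t≤s))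

  f∈Y : ∀ j {t} → t ≤ s → f j t ∈ subset onLeg?
  f∈Y j t≤s = ∈-subset⁺ onLeg? (onLeg j t≤s)

  Y : Graph n
  Y = symmetricGraph (subset onLeg?) link? λ where
    l@(j , t , refl , refl) → f∈Y j (<⇒≤ (toℕ<n t)) , f∈Y j (toℕ<n t) , λ eq → Adj-irrefl G eq (link⇒Adj l)

  Y⊑G : Y ⊑ G
  Y⊑G = (λ v∈ → let (j , t , eq) = ∈-subset⁻ onLeg? v∈ in subst (_∈ V G) eq (f∈ j (toℕ≤pred[n] t)))
      , λ { (inj₁ l) → link⇒Adj l ; (inj₂ l) → Adj-sym G (link⇒Adj l) }

  stepY : ∀ j {t} → t < s → Adj Y (f j t) (f j (suc t))
  stepY j t<s = inj₁ (j , fromℕ< t<s , cong (f j) (toℕ-fromℕ< t<s) , cong (λ x → f j (suc x)) (toℕ-fromℕ< t<s))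

  alongLeg : ∀ j {t d} → t + d ≤ s → Walk Y d (f j t) (f j (t + d))
  alongLeg j {t} {d} td≤s = segment (f j) t d (λ x< → stepY j (<-≤-trans x< td≤s)) (f∈Y j td≤s)

  toCentre : ∀ j {t} → t ≤ s → Walk Y t (f j t) (f zero 0)
  toCentre j t≤s = subst (Walk Y _ _) (sym (f₀ j)) (reverse (alongLeg j t≤s))

  quasiGeodesic : Y IsQuasiGeodesicIn G [ 3 ]
  quasiGeodesic u∈ v∈ = dist-compare G Y (3 *∞_) (λ _ → refl) refl λ W → detour (∈-subset⁻ onLeg? u∈) (∈-subset⁻ onLeg? v∈) W
    where
    sameLeg : ∀ j {t t′ ℓ} → t ≤ t′ → t′ ≤ s → Walk G ℓ (f j t) (f j t′) → Within Y (3 * ℓ) (f j t) (f j t′)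
    sameLeg j t≤t′ t′≤s W with m≤n⇒∃[o]m+o≡n t≤t′
    ... | d , refl = d , ≤-trans (same j t′≤s W) (m≤m+n _ _) , alongLeg j t′≤s
    detour : ∀ {u v ℓ} → OnLeg u → OnLeg v → Walk G ℓ u v → Within Y (3 * ℓ) u v
    detour (j , t , refl) (j′ , t′ , refl) W with j ≟ᶠ j′ | ≤-total (toℕ t) (toℕ t′)
    ... | yes refl | inj₁ t≤t′ = sameLeg j t≤t′ (toℕ≤pred[n] t′) W
    ... | yes refl | inj₂ t′≤t = within-reverse (sameLeg j t′≤t (toℕ≤pred[n] t) (reverse W))
    ... | no j≢j′  | _ = toℕ t + toℕ t′ , diff j≢j′ (toℕ≤pred[n] t) (toℕ≤pred[n] t′) W
                       , toCentre j (toℕ≤pred[n] t) ++ reverse (toCentre j′ (toℕ≤pred[n] t′))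

  branchVertex : Vertex K₁,₃ → Vertex Y
  branchVertex (zero  , _) = f zero 0 , f∈Y zero z≤n
  branchVertex (suc j , _) = f j s , f∈Y j ≤-refl

  0≢s : 0 ≢ s
  0≢s = <⇒≢ 0<s

  branchVertex-injective : ∀ x y → proj₁ (branchVertex x) ≡ proj₁ (branchVertex y) → proj₁ x ≡ proj₁ y
  branchVertex-injective (zero  , _) (zero  , _) _  = refl
  branchVertex-injective (zero  , _) (suc j , _) eq with f-injective z≤n ≤-refl eq
  ... | inj₁ (_ , 0≡s) = contradiction 0≡s 0≢s
  ... | inj₂ (_ , s≡0) = contradiction (sym s≡0) 0≢s
  branchVertex-injective (suc i , _) (zero  , _) eq with f-injective ≤-refl z≤n eq
  ... | inj₁ (_ , s≡0) = contradiction (sym s≡0) 0≢s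
  ... | inj₂ (s≡0 , _) = contradiction (sym s≡0) 0≢s
  branchVertex-injective (suc i , _) (suc j , _) eq with f-injective ≤-refl ≤-refl eq
  ... | inj₁ (i≡j , _) = cong suc i≡j
  ... | inj₂ (s≡0 , _) = contradiction (sym s≡0) 0≢s

  -- Any edge equals a spoke, so questions about the paths of two edges reduce to the legs with the
  -- recorded indices.
  record Leg (e : Edge K₁,₃) : Set where
    field
      index     : Fin 3
      e≡spoke   : e ≡ spoke index
      route     : Path Y (proj₁ (branchVertex (src e))) (proj₁ (branchVertex (tgt e)))
      length≡s  : length route ≡ s
      at-route  : ∀ i → at (walk route) i ≡ f index (toℕ i)

  leg : ∀ e → Leg e
  leg e@record { src = zero , _ ; tgt = suc j , _ } = record
    { index    = j
    ; e≡spoke  = edge-≡ {e = e} {spoke j} refl refl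
    ; route    = record { walk = W ; simple = λ {x} {y} eq → simpleW (trans (sym (at-W x)) (trans eq (at-W y))) }
    ; length≡s = refl
    ; at-route = at-W
    }
    where
    W = follow (f j) s (stepY j) (f∈Y j ≤-refl) (sym (f₀ j)) refl
    at-W = at-follow (f j) s (stepY j) (f∈Y j ≤-refl) (sym (f₀ j)) refl
    simpleW : ∀ {x y : Fin (suc s)} → f j (toℕ x) ≡ f j (toℕ y) → x ≡ y
    simpleW {x} {y} eq with f-injective {j} {j} (toℕ≤pred[n] x) (toℕ≤pred[n] y) eq
    ... | inj₁ (_ , x≡y) = toℕ-injective x≡y
    ... | inj₂ (x≡0 , y≡0) = toℕ-injective (trans x≡0 (sym y≡0))
  -- No edge ends at the centre, since edges are oriented upwards, and none joins two leaves.
  leg record { src = zero , _ ; tgt = zero , _ ; ordered = () }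
  leg record { src = suc _ , _ ; tgt = zero , _ ; ordered = () }
  leg record { src = suc _ , _ ; tgt = suc _ , _ ; adj = adj } = ⊥-elim-irr (leaves-independent adj)

  open Leg

  interior⇒ : ∀ e {v} → Interior (walk (route (leg e))) v →
              ∃[ t ] 0 < t × t < s × f (index (leg e)) t ≡ v
  interior⇒ e (i , i≢0 , i≢end , eq) = toℕ i
    , n≢0⇒n>0 (λ i≡0 → i≢0 (toℕ-injective i≡0))
    , ≤∧≢⇒< (≤-trans (toℕ≤pred[n] i) (≤-reflexive (length≡s (leg e))))
            (λ i≡s → i≢end (toℕ-injective (trans i≡s (sym (trans (toℕ-fromℕ _) (length≡s (leg e)))))))
    , trans (sym (at-route (leg e) i)) eq

  interior-injective : ∀ {j j′ t t′} → 0 < t → t < s → t′ ≤ s → f j t ≡ f j′ t′ → j ≡ j′ × t ≡ t′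
  interior-injective 0<t t<s t′≤s eq with f-injective (<⇒≤ t<s) t′≤s eq
  ... | inj₁ p = p
  ... | inj₂ (t≡0 , _) = contradiction (sym t≡0) (<⇒≢ 0<t)

  index-spoke : ∀ j → index (leg (spoke j)) ≡ j
  index-spoke j = sym (suc-injective (cong (λ e → proj₁ (tgt e)) (e≡spoke (leg (spoke j)))))

  at-spoke : ∀ j i → at (walk (route (leg (spoke j)))) i ≡ f j (toℕ i)
  at-spoke j i = trans (at-route (leg (spoke j)) i) (cong (λ x → f x (toℕ i)) (index-spoke j))

  isSubdivision : ∀ k → k + 1 ≤ s → IsSubdivision≥ k K₁,₃ Y
  isSubdivision k k<s = record
    { branch = branchVertex
    ; branch-inj = λ {x} {y} eq → vertex-≡ {G = K₁,₃} (branchVertex-injective x y (cong proj₁ eq))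
    ; path = λ e → route (leg e)
    ; long = λ e → ≤-trans k<s (≤-reflexive (sym (length≡s (leg e))))
    ; disjoint-V = λ e x i → avoid x (interior⇒ e i)
    ; disjoint = λ e e′ i i′ → meet e e′ (interior⇒ e i) (interior⇒ e′ i′)
    ; exhaust-V = λ v∈ → exhaust (∈-subset⁻ onLeg? v∈)
    ; exhaust-E = λ { (inj₁ l) → traverse l
                    ; (inj₂ l) → let (e , i , T) = traverse l in e , i , swap T }
    }
    where
    avoid : ∀ {j} x → ∃[ t ] 0 < t × t < s × f j t ≡ proj₁ (branchVertex x) → ⊥
    avoid (zero  , _) (t , 0<t , t<s , eq) = <⇒≢ 0<t (sym (proj₂ (interior-injective {j′ = zero} 0<t t<s z≤n eq)))
    avoid (suc i , _) (t , 0<t , t<s , eq) = <⇒≢ t<s (proj₂ (interior-injective {j′ = i} 0<t t<s ≤-refl eq))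
    meet : ∀ e e′ {v} → ∃[ t ] 0 < t × t < s × f (index (leg e)) t ≡ v →
           ∃[ t ] 0 < t × t < s × f (index (leg e′)) t ≡ v → e ≡ e′
    meet e e′ (t , 0<t , t<s , eq) (t′ , _ , t′<s , eq′) =
      trans (e≡spoke (leg e)) (trans
        (cong spoke (proj₁ (interior-injective 0<t t<s (<⇒≤ t′<s) (trans eq (sym eq′)))))
        (sym (e≡spoke (leg e′))))
    exhaust : ∀ {v} → OnLeg v → (∃ λ x → proj₁ (branchVertex x) ≡ v) ⊎
              (∃ λ e → Interior (walk (route (leg e))) v)
    exhaust (j , t , refl) with toℕ t ≟ 0 | toℕ t ≟ s
    ... | yes t≡0 | _ = inj₁ ((zero , ∈⊤) , trans (f₀ j) (cong (f j) (sym t≡0)))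
    ... | no _ | yes t≡s = inj₁ ((suc j , ∈⊤) , cong (f j) (sym t≡s))
    ... | no t≢0 | no t≢s = inj₂ (spoke j , t , (λ eq → t≢0 (cong toℕ eq))
                              , (λ eq → t≢s (trans (cong toℕ eq) (toℕ-fromℕ s))) , at-spoke j t)
    traverse : ∀ {u v} → Link u v → ∃ λ e → Σ[ i ∈ Fin (length (route (leg e))) ]
      ((at (walk (route (leg e))) (inject₁ i) ≡ u × at (walk (route (leg e))) (suc i) ≡ v) ⊎
       (at (walk (route (leg e))) (inject₁ i) ≡ v × at (walk (route (leg e))) (suc i) ≡ u))
    traverse (j , t , eq , eq′) = spoke j , t , inj₁
      ( trans (at-spoke j (inject₁ t)) (trans (cong (f j) (toℕ-inject₁ t)) eq)
      , trans (at-spoke j (suc t)) eq′)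

HasClaw : ℕ → Graph n → Set₁
HasClaw {n} K G = Σ[ Y ∈ Graph n ] (Y ⊑ G × IsSubdivision≥ K K₁,₃ Y × Y IsQuasiGeodesicIn G [ 3 ])

-- The legs `a` and `b` run along a core in its two directions, and `q` leads away from it. That `q`
-- is geodesic follows from `farA` at t′ = 0.
module _ (G : Graph n) (s : ℕ) (0<s : 0 < s) (a b q : ℕ → Fin n) (a≡b : a 0 ≡ b 0) (a≡q : a 0 ≡ q 0)
  (stepA : ∀ {t} → t < s → Adj G (a t) (a (suc t)))
  (stepB : ∀ {t} → t < s → Adj G (b t) (b (suc t)))
  (stepQ : ∀ {t} → t < s → Adj G (q t) (q (suc t)))
  (geodA : ∀ {t d ℓ} → t + d ≤ s → Walk G ℓ (a t) (a (t + d)) → d ≤ ℓ)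
  (geodB : ∀ {t d ℓ} → t + d ≤ s → Walk G ℓ (b t) (b (t + d)) → d ≤ ℓ)
  (apart : ∀ {t t′ ℓ} → t ≤ s → t′ ≤ s → Walk G ℓ (a t) (b t′) → t + t′ ≤ 3 * ℓ)
  (farA : ∀ {t t′ ℓ} → t ≤ s → t′ ≤ s → Walk G ℓ (q t) (a t′) → t ≤ ℓ)
  (farB : ∀ {t t′ ℓ} → t ≤ s → t′ ≤ s → Walk G ℓ (q t) (b t′) → t ≤ ℓ)
  where

  private
    arm : Fin 3 → ℕ → Fin n
    arm zero          = a
    arm (suc zero)    = b
    arm (suc (suc _)) = q

    arm₀ : ∀ j → a 0 ≡ arm j 0
    arm₀ zero          = refl
    arm₀ (suc zero)    = a≡b
    arm₀ (suc (suc _)) = a≡q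

    stepArm : ∀ j {t} → t < s → Adj G (arm j t) (arm j (suc t))
    stepArm zero          = stepA
    stepArm (suc zero)    = stepB
    stepArm (suc (suc _)) = stepQ

    fromCentre : ∀ {t} → t ≤ s → Walk G t (q 0) (q t)
    fromCentre {zero}  0≤s = stop (Adj⇒∈V G (stepQ 0<s))
    fromCentre {suc t} t<s = follow q (suc t) (λ x<t → stepQ (<-≤-trans x<t t<s))
      (Adj⇒∈V G (Adj-sym G (stepQ t<s))) refl refl

    geodArm : ∀ j {t d ℓ} → t + d ≤ s → Walk G ℓ (arm j t) (arm j (t + d)) → d ≤ ℓ
    geodArm zero          = geodA
    geodArm (suc zero)    = geodB
    geodArm (suc (suc _)) {t} {d} {ℓ} t+d≤s W = +-cancelˡ-≤ t d ℓ (≤-trans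
      (farA t+d≤s z≤n (reverse W ++ subst (Walk G t (q t)) (sym a≡q) (reverse (fromCentre (m+n≤o⇒m≤o t t+d≤s)))))
      (≤-reflexive (+-comm ℓ t)))

    arith : ∀ {t t′ ℓ} → t ≤ ℓ → t′ ≤ t + ℓ → t + t′ ≤ 3 * ℓ
    arith {t} {t′} {ℓ} p q = lin 0 (+-mono-≤ (+-mono-≤ p p) q) (solve (t ◂ t′ ◂ ℓ ◂ []))

    -- The detour through the centre costs at most t + (t + ℓ), where t ≤ ℓ.
    detourA : ∀ {t t′ ℓ} → t ≤ s → t′ ≤ s → Walk G ℓ (q t) (a t′) → t + t′ ≤ 3 * ℓ
    detourA t≤s t′≤s W = arith (farA t≤s t′≤s W)
      (geodA t′≤s (subst (λ c → Walk G _ c _) (sym a≡q) (fromCentre t≤s ++ W)))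

    detourB : ∀ {t t′ ℓ} → t ≤ s → t′ ≤ s → Walk G ℓ (q t) (b t′) → t + t′ ≤ 3 * ℓ
    detourB t≤s t′≤s W = arith (farB t≤s t′≤s W)
      (geodB t′≤s (subst (λ c → Walk G _ c _) (trans (sym a≡q) a≡b) (fromCentre t≤s ++ W)))

    flip : ∀ {t t′ x} → t + t′ ≤ x → t′ + t ≤ x
    flip {t} {t′} = ≤-trans (≤-reflexive (+-comm t′ t))

    apartArm : ∀ {j j′ t t′ ℓ} → j ≢ j′ → t ≤ s → t′ ≤ s → Walk G ℓ (arm j t) (arm j′ t′) → t + t′ ≤ 3 * ℓ
    apartArm {zero}          {zero}          j≢j _ _ _ = contradiction refl j≢j
    apartArm {zero}          {suc zero}      _ p q W = apart p q W
    apartArm {zero}          {suc (suc _)}   {t} {t′} _ p q W = flip {t′} {t} (detourA q p (reverse W))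
    apartArm {suc zero}      {zero}          {t} {t′} _ p q W = flip {t′} {t} (apart q p (reverse W))
    apartArm {suc zero}      {suc zero}      j≢j _ _ _ = contradiction refl j≢j
    apartArm {suc zero}      {suc (suc _)}   {t} {t′} _ p q W = flip {t′} {t} (detourB q p (reverse W))
    apartArm {suc (suc _)}   {zero}          _ p q W = detourA p q W
    apartArm {suc (suc _)}   {suc zero}      _ p q W = detourB p q W
    apartArm {suc (suc zero)} {suc (suc zero)} j≢j _ _ _ = contradiction refl j≢j

  claw : ∀ K → K + 1 ≤ s → HasClaw K G
  claw K K<s = Y , Y⊑G , isSubdivision K K<s , quasiGeodesic
    where open Claw G s 0<s arm arm₀ stepArm geodArm apartArm

-- Parity of walks

module _ {G : Graph n} where

  take-! : ∀ a {u v t} (W : Walk G (a + b) u v) → t ≤ a → take a W ! t ≡ W ! t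
  take-! zero    (stop _) z≤n       = refl
  take-! zero    (_ ∷ _)  z≤n       = refl
  take-! (suc a) (_ ∷ W)  z≤n       = refl
  take-! (suc a) (_ ∷ W)  (s≤s t≤a) = take-! a W t≤a

  drop-! : ∀ a {u v} (W : Walk G (a + b) u v) t → drop a W ! t ≡ W ! (a + t)
  drop-! zero    (stop _) t = refl
  drop-! zero    (_ ∷ _)  t = refl
  drop-! (suc a) (_ ∷ W)  t = drop-! a W t

  ++-! : ∀ {u v w} (W : Walk G a u v) (X : Walk G b v w) t → t ≤ a + b →
         (∃[ t′ ] t′ ≤ a × (W ++ X) ! t ≡ W ! t′) ⊎ (∃[ t′ ] t′ ≤ b × (W ++ X) ! t ≡ X ! t′)
  ++-! (stop _) X t       t≤    = inj₂ (t , t≤ , refl)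
  ++-! (e ∷ W)  X zero    _     = inj₁ (0 , z≤n , refl)
  ++-! (e ∷ W)  X (suc t) (s≤s t≤) with ++-! W X t t≤
  ... | inj₁ (t′ , t′≤ , eq) = inj₁ (suc t′ , s≤s t′≤ , eq)
  ... | inj₂ p               = inj₂ p

module Parity (G : Graph n) (χ : Fin n → Fin n → Bool) (χ-sym : ∀ u v → χ u v ≡ χ v u) where

  par : ∀ {u v} → Walk G ℓ u v → Bool
  par (stop _)            = false
  par (_∷_ {u = u} {w} _ W) = χ u w xor par W

  par-++ : ∀ {u v w} (W : Walk G a u v) (X : Walk G b v w) → par (W ++ X) ≡ par W xor par X
  par-++ (stop _) X = refl
  par-++ (_∷_ {u = u} {w} _ W) X = trans (cong (χ u w xor_) (par-++ W X)) (sym (xor-assoc (χ u w) (par W) (par X)))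

  par-subst : ∀ {u v} (eq : a ≡ b) (W : Walk G a u v) → par (subst (λ l → Walk G l u v) eq W) ≡ par W
  par-subst refl W = refl

  par-reverse : ∀ {u v} (W : Walk G ℓ u v) → par (reverse W) ≡ par W
  par-reverse (stop _) = refl
  par-reverse {ℓ = suc ℓ} (_∷_ {u = u} {w} e W) = begin
    par (reverse (e ∷ W))                        ≡⟨ par-subst (+-comm ℓ 1) (reverse W ++ edge (Adj-sym G e)) ⟩
    par (reverse W ++ edge (Adj-sym G e))        ≡⟨ par-++ (reverse W) _ ⟩
    par (reverse W) xor (χ w u xor false)        ≡⟨ cong₂ _xor_ (par-reverse W) (trans (xor-identityʳ _) (χ-sym w u)) ⟩
    par W xor χ u w                              ≡⟨ xor-comm (par W) _ ⟩
    χ u w xor par W                              ∎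
    where open ≡-Reasoning

  par-split : ∀ a {u v} (W : Walk G (a + b) u v) → par W ≡ par (take a W) xor par (drop a W)
  par-split zero    (stop _) = refl
  par-split zero    (_ ∷ _)  = refl
  par-split (suc a) (_∷_ {u = u} {w} _ W) = trans (cong (χ u w xor_) (par-split a W)) (sym (xor-assoc (χ u w) _ _))

  OddClosed : ℕ → Set
  OddClosed ℓ = ∃[ u ] Σ[ W ∈ Walk G ℓ u u ] par W ≡ true

  parity? : ∀ ℓ u v p → Dec (Σ[ W ∈ Walk G ℓ u v ] par W ≡ p)
  parity? zero u v p with walk? G 0 u v
  ... | no ¬W = no λ (W , _) → ¬W W
  ... | yes W = map′ (λ eq → W , trans (even W) eq) (λ (X , eq) → trans (sym (even X)) eq) (false ≟ᵇ p)
    where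
    even : ∀ {u v} (W : Walk G 0 u v) → par W ≡ false
    even (stop _) = refl
  parity? (suc ℓ) u v p =
    map′ (λ (w , e , W , eq) → e ∷ W , trans (cong (χ u w xor_) eq) (xor-xor (χ u w) p))
         (λ { (_∷_ {w = w} e W , eq) → w , e , W , trans (sym (xor-xor (χ u w) (par W))) (cong (χ u w xor_) eq) })
         (any? λ w → Adj? G u w ×-dec parity? ℓ w v (χ u w xor p))
    where
    xor-xor : ∀ x y → x xor (x xor y) ≡ y
    xor-xor true  true  = refl
    xor-xor true  false = refl
    xor-xor false _     = refl

  shortestOddClosed : OddClosed ℓ → ∃[ N ] OddClosed N × (∀ {ℓ} → OddClosed ℓ → N ≤ ℓ)
  shortestOddClosed = leastNat λ ℓ → any? λ u → parity? ℓ u u true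

  rotate : ∀ a {u} (W : Walk G (a + b) u u) → Walk G (b + a) (W ! a) (W ! a)
  rotate a W = drop a W ++ take a W

  par-rotate : ∀ a {u} (W : Walk G (a + b) u u) → par (rotate a W) ≡ par W
  par-rotate a W = trans (par-++ (drop a W) (take a W))
    (trans (xor-comm (par (drop a W)) _) (sym (par-split a W)))

  rotate-! : ∀ a {u t} (W : Walk G (a + b) u u) → t ≤ b + a → ∃[ t′ ] t′ ≤ a + b × rotate a W ! t ≡ W ! t′
  rotate-! {b = b} a {t = t} W t≤ with ++-! (drop a W) (take a W) t t≤
  ... | inj₁ (t′ , t′≤b , eq) = a + t′ , +-monoʳ-≤ a t′≤b , trans eq (drop-! a W t′)
  ... | inj₂ (t′ , t′≤a , eq) = t′ , ≤-trans t′≤a (m≤m+n a b) , trans eq (take-! a W t′≤a)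

  -- A chord splits a closed walk into two, one of which is odd if the walk is.
  chord : ∀ a d {e u} (W : Walk G (a + (d + e)) u u) → par W ≡ true →
          Walk G ℓ (W ! a) (W ! (a + d)) → OddClosed (d + ℓ) ⊎ OddClosed (a + (ℓ + e))
  chord {ℓ = ℓ} a d {e} W odd S = split
    (closed₁ , trans (par-++ B (reverse S′)) (cong (par B xor_) (par-reverse S′)))
    (closed₂ , trans (par-++ A (S′ ++ D)) (cong (par A xor_) (par-++ S′ D)))
    (cases (par A) (par B) (par D) (par S′)
      (trans (sym (trans (par-split a W) (cong (par A xor_) (par-split d (drop a W))))) odd))
    where
    A = take a W
    B = take d (drop a W)
    D = drop d (drop a W)
    S′ : Walk G ℓ (W ! a) (drop a W ! d)
    S′ = subst (Walk G ℓ (W ! a)) (sym (drop-! a W d)) S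
    closed₁ = B ++ reverse S′
    closed₂ = A ++ (S′ ++ D)
    cases : ∀ a b d s → a xor (b xor d) ≡ true → b xor s ≡ true ⊎ a xor (s xor d) ≡ true
    cases a true  d true  eq = inj₂ eq
    cases a true  d false eq = inj₁ refl
    cases a false d true  eq = inj₁ refl
    cases a false d false eq = inj₂ eq
    split : ∀ {x y p q v w} → Σ[ X ∈ Walk G x v v ] par X ≡ p → Σ[ Z ∈ Walk G y w w ] par Z ≡ q →
            p ≡ true ⊎ q ≡ true → OddClosed x ⊎ OddClosed y
    split (X , eq) _ (inj₁ eq′) = inj₁ (_ , X , trans eq eq′)
    split _ (Z , eq) (inj₂ eq′) = inj₂ (_ , Z , trans eq eq′)

  module _ {N : ℕ} (shortest : ∀ {ℓ} → OddClosed ℓ → N ≤ ℓ) where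

    -- By `chord`, S forms an odd closed walk either with the arc of length d, so N ≤ d + ℓ, or with
    -- the rest of W. In the second case S replaces the arc without making W shorter, so d ≤ ℓ.
    shortest-isometric : ∀ {u} (W : Walk G N u u) → par W ≡ true → ∀ {t d} → t + d ≤ N →
                         Walk G ℓ (W ! t) (W ! (t + d)) → d ≤ ℓ ⊎ N ≤ d + ℓ
    shortest-isometric {ℓ = ℓ} W odd {t} {d} t+d≤N S with m≤n⇒∃[o]m+o≡n t+d≤N
    ... | e , eq with trans (sym (+-assoc t d e)) eq
    ...   | refl with chord t d W odd S
    ...     | inj₁ C = inj₂ (shortest C)
    ...     | inj₂ C = inj₁ (+-cancelʳ-≤ e d ℓ (+-cancelˡ-≤ t (d + e) (ℓ + e) (shortest C)))

-- Geodesics in claw-free graphs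

!∈ : {G : Graph n} → ∀ {u v} (W : Walk G ℓ u v) t → W ! t ∈ V G
!∈ (stop u∈) t       = u∈
!∈ (e ∷ W)   zero    = source∈ (e ∷ W)
!∈ (e ∷ W)   (suc t) = !∈ W t

∸-suc : ∀ {t i} → t < i → i ∸ t ≡ suc (i ∸ suc t)
∸-suc {zero}  {suc i} _         = refl
∸-suc {suc t} {suc i} (s≤s t<i) = ∸-suc t<i

module Track (G : Graph n) (conn : Connected G) {u v : Fin n} (P : Walk G m u v) where

  point : Fin (suc m) → Fin n
  point i = P ! toℕ i

  open Voronoi G conn point (λ i → !∈ P (toℕ i)) public

  point-clamp : ∀ {t} → t ≤ m → P ! t ≡ point (clamp m t)
  point-clamp t≤m = cong (P !_) (sym (toℕ-clamp t≤m))

  spike : ∀ {y t x} {i : Fin n} (Q : Walk G (height y) y i) → t ≤ height y → x ≤ m →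
          Walk G ℓ (reverse Q ! t) (P ! x) → t ≤ ℓ
  spike Q t≤h x≤m W = ascent Q t≤h (subst (Walk G _ _) (point-clamp x≤m) W)

  module Geodesic (geodesic : ∀ {ℓ} → Walk G ℓ u v → m ≤ ℓ) where

    -- Replacing the stretch of P between the two positions by S gives a walk from u to v, which has
    -- at least m steps.
    between : ∀ t d {t′} → t + d ≡ t′ → t′ ≤ m → Walk G ℓ (P ! t) (P ! t′) → d ≤ ℓ
    between {ℓ = ℓ} t d refl t+d≤m S with m≤n⇒∃[o]m+o≡n t+d≤m
    ... | e , eq = +-cancelʳ-≤ e d ℓ (+-cancelˡ-≤ t (d + e) (ℓ + e) (begin
      t + (d + e) ≡⟨ +-assoc t d e ⟨
      t + d + e   ≡⟨ eq ⟩
      m           ≤⟨ geodesic (detour (trans (sym (+-assoc t d e)) eq) eq P S) ⟩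
      t + (ℓ + e) ∎))
      where
      open ≤-Reasoning
      detour : ∀ {m} → t + (d + e) ≡ m → t + d + e ≡ m → (P : Walk G m u v) →
               Walk G ℓ (P ! t) (P ! (t + d)) → Walk G (t + (ℓ + e)) u v
      detour eq₁ eq₂ P S = first eq₁ P ++ (S ++ last eq₂ P)
        where
        first : ∀ {t x m} → t + x ≡ m → (P : Walk G m u v) → Walk G t u (P ! t)
        first {t} refl P = take t P
        last : ∀ {t x m} → t + x ≡ m → (P : Walk G m u v) → Walk G x (P ! t) v
        last {t} refl P = drop t P

    -- Otherwise P continues for K + 1 steps on both sides of i, and these two stretches form a claw
    -- with the last K + 1 steps of Q. Here i may be any nearest point, not only `proj y`.
    nearest-at-ends : ∀ K → ¬ HasClaw K G → ∀ {y i} → Walk G (height y) y (point i) → K < height y →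
                      toℕ i ≤ K ⊎ m ≤ toℕ i + K
    nearest-at-ends K noClaw {y} {i} Q K<h with toℕ i ≤? K | m ≤? toℕ i + K
    ... | yes p | _     = inj₁ p
    ... | no _  | yes p = inj₂ p
    ... | no p  | no q  = contradiction
      (claw G (suc K) z<s (λ t → P ! (c ∸ t)) (λ t → P ! (c + t)) (λ t → reverse Q ! t)
        (cong (P !_) (sym (+-identityʳ c))) (sym (!-start (reverse Q)))
        (λ {t} t<s → subst (λ x → Adj G (P ! x) (P ! (c ∸ suc t))) (sym (∸-suc (<-≤-trans t<s s≤c)))
                   (Adj-sym G (!-step P (≤-<-trans (m∸n≤m c (suc t)) c<m))))
        (λ {t} t<s → subst (λ x → Adj G (P ! (c + t)) (P ! x)) (sym (+-suc c t)) (!-step P (<-≤-trans (+-monoʳ-< c t<s) c+s≤m)))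
        (λ t<s → !-step (reverse Q) (<-≤-trans t<s K<h))
        (λ {t} {d} t+d≤s W → between (c ∸ (t + d)) d (back t d t+d≤s) (≤-trans (m∸n≤m c t) (<⇒≤ c<m)) (reverse W))
        (λ {t} {d} t+d≤s → between (c + t) d (+-assoc c t d) (≤-trans (+-monoʳ-≤ c t+d≤s) c+s≤m))
        (λ {t} {t′} {ℓ} t≤s t′≤s W → ≤-trans
           (between (c ∸ t) (t + t′) (across t t′ t≤s) (≤-trans (+-monoʳ-≤ c t′≤s) c+s≤m) W)
           (m≤m+n ℓ (2 * ℓ)))
        (λ {t} {t′} t≤s t′≤s → spike {x = c ∸ t′} Q (≤-trans t≤s K<h) (≤-trans (m∸n≤m c t′) (<⇒≤ c<m)))
        (λ {t} {t′} t≤s t′≤s → spike {x = c + t′} Q (≤-trans t≤s K<h) (≤-trans (+-monoʳ-≤ c t′≤s) c+s≤m))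
        K (≤-reflexive (+-comm K 1)))
      noClaw
      where
      c = toℕ i
      s≤c : suc K ≤ c
      s≤c = ≰⇒> p
      c+s≤m : c + suc K ≤ m
      c+s≤m = ≤-trans (≤-reflexive (+-suc c K)) (≰⇒> q)
      c<m : c < m
      c<m = <-≤-trans (m<m+n c z<s) c+s≤m
      back : ∀ t d → t + d ≤ suc K → c ∸ (t + d) + d ≡ c ∸ t
      back t d t+d≤s = trans (cong (_+ d) (sym (∸-+-assoc c t d)))
        (m∸n+n≡m (m+n≤o⇒m≤o∸n d (≤-trans (≤-reflexive (+-comm d t)) (≤-trans t+d≤s s≤c))))
      across : ∀ t t′ → t ≤ suc K → c ∸ t + (t + t′) ≡ c + t′
      across t t′ t≤s = trans (sym (+-assoc (c ∸ t) t t′)) (cong (_+ t′) (m∸n+n≡m (≤-trans t≤s s≤c)))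

-- Far vertices, their sides, and odd closed walks.

≤ᵇ-true : ∀ {x y} → (x ≤ᵇ y) ≡ true → x ≤ y
≤ᵇ-true {x} {y} eq = ≤ᵇ⇒≤ x y (subst T (sym eq) tt)

≤ᵇ-false : ∀ {x y} → (x ≤ᵇ y) ≡ false → y < x
≤ᵇ-false eq = ≰⇒> λ x≤y → subst T eq (≤⇒≤ᵇ x≤y)

xor-telescope : ∀ p q r → (p xor q) xor (q xor r) ≡ p xor r
xor-telescope p true  r = trans (cong (_xor not r) (xor-comm p true)) (not-xor p r)
  where
  not-xor : ∀ p r → not p xor not r ≡ p xor r
  not-xor true  r = refl
  not-xor false r = not-involutive r
xor-telescope p false r = cong (_xor r) (xor-identityʳ p)

-- `f`, `g` stand for `far` and `l`, `r` for `left` at the two ends of an edge. Its mark `χ` agrees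
-- with the change of `potential β` unless exactly one end is far and that end lies on side `not β`.
coboundary-step : ∀ f g l r β →
  (f ∧ g) ∧ (l xor r) ≡ (f ∧ (l xor β)) xor (g ∧ (r xor β)) ⊎
  (f ≡ true × g ≡ false × l ≡ not β) ⊎ (f ≡ false × g ≡ true × r ≡ not β)
coboundary-step true  true  l r β = inj₁ (sym (trans (cong ((l xor β) xor_) (xor-comm r β)) (xor-telescope l β r)))
coboundary-step false false l r β = inj₁ refl
coboundary-step true  false true  r true  = inj₁ refl
coboundary-step true  false true  r false = inj₂ (inj₁ (refl , refl , refl))
coboundary-step true  false false r true  = inj₂ (inj₁ (refl , refl , refl))
coboundary-step true  false false r false = inj₁ refl
coboundary-step false true  l true  true  = inj₁ refl
coboundary-step false true  l true  false = inj₂ (inj₂ (refl , refl , refl))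
coboundary-step false true  l false true  = inj₂ (inj₂ (refl , refl , refl))
coboundary-step false true  l false false = inj₁ refl

module Sides (K : ℕ) (G : Graph n) (conn : Connected G) (noClaw : ¬ HasClaw K G)
             {u v : Fin n} (P : Walk G m u v) (geodesic : ∀ {ℓ} → Walk G ℓ u v → m ≤ ℓ)
             (long : 6 * K + 3 ≤ m) where

  open Track G conn P public
  open Geodesic geodesic public

  spread : ∀ {i j} → Walk G ℓ (point i) (point j) → toℕ j ≤ toℕ i + ℓ
  spread {ℓ = ℓ} {i} {j} W with ≤-total (toℕ i) (toℕ j)
  ... | inj₂ j≤i = ≤-trans j≤i (m≤m+n (toℕ i) ℓ)
  ... | inj₁ i≤j with m≤n⇒∃[o]m+o≡n i≤j
  ...   | d , eq = ≤-trans (≤-reflexive (sym eq))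
                     (+-monoʳ-≤ (toℕ i) (between (toℕ i) d eq (toℕ≤pred[n] j) W))

  Side : Bool → Fin (suc m) → Set
  Side true  i = toℕ i ≤ K
  Side false i = m ≤ toℕ i + K

  -- At a far vertex that is not `left`, the projection is among the last K + 1 points of P, by
  -- `nearest-at-ends`.
  far left : Fin n → Bool
  far  x = K <ᵇ height x
  left x = toℕ (proj x) ≤ᵇ K

  χ : Fin n → Fin n → Bool
  χ x y = (far x ∧ far y) ∧ (left x xor left y)

  χ-sym : ∀ x y → χ x y ≡ χ y x
  χ-sym x y = cong₂ _∧_ (∧-comm (far x) (far y)) (xor-comm (left x) (left y))

  open Parity G χ χ-sym public

  Landing : Bool → Fin n → Set
  Landing β z = height z ≤ K × Side β (proj z)

  private
    -- The hypotheses give 5K + 3 ≤ j and j ≤ 3K + 2.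
    crowded : ∀ {i j h} → 6 * K + 3 ≤ m → m ≤ j + K → j ≤ i + (h + h) → h ≤ suc K → i ≤ K → 2 * K + 1 ≤ 0
    crowded {i} {j} {h} p q r s t = lin 0 (+-mono-≤ (+-mono-≤ p q) (+-mono-≤ r (+-mono-≤ t (+-mono-≤ s s))))
      (solve (i ◂ j ◂ h ◂ K ◂ m ◂ []))

  -- y and z have a common nearest point, and the nearest points of y are too
  -- close to each other to lie on different sides.
  landing : ∀ {y z} → Adj G y z → far y ≡ true → far z ≡ false → Landing (left y) z
  landing {y} {z} e fy fz = hz≤K , side (left y) refl
    where
    K<hy = ≤ᵇ-true fy
    hz≤K = ≤-pred (≤ᵇ-false fz)
    hy≤ : height y ≤ suc (height z)
    hy≤ = height-step (edge e)
    y∈ = Adj⇒∈V G e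
    z∈ = Adj⇒∈V G (Adj-sym G e)
    Q : Walk G (height y) y (point (proj z))
    Q = subst (λ h → Walk G h y (point (proj z))) (≤-antisym (≤-trans (s≤s hz≤K) K<hy) hy≤) (e ∷ descent z∈)
    side : ∀ β → left y ≡ β → Side β (proj z)
    side true eq with nearest-at-ends K noClaw Q K<hy
    ... | inj₁ p = p
    ... | inj₂ q = contradiction
      (crowded {i = toℕ (proj y)} {h = height y} long q (spread {i = proj y} {proj z} (reverse (descent y∈) ++ Q))
        (≤-trans hy≤ (s≤s hz≤K)) (≤ᵇ-true eq))
      (λ le → m+1+n≰m (2 * K) {0} (≤-trans le z≤n))
    side false eq with nearest-at-ends K noClaw (descent y∈) K<hy
    ... | inj₁ p = contradiction p (<⇒≱ (≤ᵇ-false eq))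
    ... | inj₂ q = ≤-trans q (+-monoˡ-≤ K (proj-min Q))

  -- The projections are at least m - 2K apart on P, and each landing is within K of its own.
  opposite-landings : ∀ {z z′} → Landing true z → Landing false z′ → Walk G ℓ z z′ → m ≤ 4 * K + ℓ
  opposite-landings {ℓ = ℓ} {z} {z′} (h , s) (h′ , s′) W = arith s′
    (spread {i = proj z} {proj z′} (reverse (descent (source∈ W)) ++ (W ++ descent (target∈ W)))) s h h′
    where
    arith : ∀ {i j h h′} → m ≤ j + K → j ≤ i + (h + (ℓ + h′)) → i ≤ K → h ≤ K → h′ ≤ K → m ≤ 4 * K + ℓ
    arith {i} {j} {h} {h′} p q r s t = lin 0 (+-mono-≤ p (+-mono-≤ q (+-mono-≤ r (+-mono-≤ s t))))
      (solve (i ◂ j ◂ h ◂ h′ ◂ K ◂ m ◂ ℓ ◂ []))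

  -- The indicator of the far vertices on side `not β`.
  potential : Bool → Fin n → Bool
  potential β x = far x ∧ (left x xor β)

  -- χ is the coboundary of potential β, except on edges that land on the other side.
  coboundary : ∀ β {x y} (W : Walk G ℓ x y) →
    par W ≡ potential β x xor potential β y ⊎ ∃[ t ] t ≤ ℓ × Landing (not β) (W ! t)
  coboundary β {x} (stop _) = inj₁ (sym (xor-same (potential β x)))
  coboundary β {x} {y} (_∷_ {w = w} e W) with coboundary β W
  ... | inj₂ (t , t≤ , L) = inj₂ (suc t , s≤s t≤ , L)
  ... | inj₁ eq with coboundary-step (far x) (far w) (left x) (left w) β
  ...   | inj₁ eq′ = inj₁ (trans (cong₂ _xor_ eq′ eq) (xor-telescope (potential β x) (potential β w) (potential β y)))
  ...   | inj₂ (inj₁ (fx , fw , l)) =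
          inj₂ (1 , s≤s z≤n , subst₂ Landing l (sym (!-start W)) (landing e fx fw))
  ...   | inj₂ (inj₂ (fx , fw , l)) =
          inj₂ (0 , z≤n , subst (λ b → Landing b x) l (landing (Adj-sym G e) fw fx))

  -- A coboundary sums to zero around a closed walk, so an odd one must use an exceptional edge of
  -- `coboundary`.
  odd-lands : ∀ β {x} (W : Walk G ℓ x x) → par W ≡ true → ∃[ t ] t ≤ ℓ × Landing (not β) (W ! t)
  odd-lands β {x} W odd with coboundary β W
  ... | inj₂ L  = L
  ... | inj₁ eq = contradiction (trans (sym odd) (trans eq (xor-same (potential β x)))) λ ()

  -- The walk lands on both sides. Rotated to start at one landing, it is cut by the other into two
  -- walks, each of length at least m - 4K.
  odd-long : OddClosed ℓ → 2 * m ≤ 8 * K + ℓ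
  odd-long {ℓ = ℓ} (x , W , odd) with odd-lands false W odd
  ... | t , t≤ , L with m≤n⇒∃[o]m+o≡n t≤
  ...   | e , refl with odd-lands true (rotate t W) (trans (par-rotate t W) odd)
  ...     | t′ , t′≤ , L′ with m≤n⇒∃[o]m+o≡n t′≤
  ...       | e′ , eq = arith (opposite-landings L L′ (proj₁ (halves eq (rotate t W))))
                              (opposite-landings L L′ (reverse (proj₂ (halves eq (rotate t W)))))
                              (trans eq (+-comm e t))
    where
    halves : ∀ {N z} → t′ + e′ ≡ N → (W : Walk G N z z) → Walk G t′ z (W ! t′) × Walk G e′ (W ! t′) z
    halves refl W = take t′ W , drop t′ W
    arith : ∀ {N} → m ≤ 4 * K + t′ → m ≤ 4 * K + e′ → t′ + e′ ≡ N → 2 * m ≤ 8 * K + N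
    arith p q refl = lin 0 (+-mono-≤ p q) (solve (m ◂ K ◂ t′ ◂ e′ ◂ []))

  -- Before the landing all vertices are far, so the marks are differences of `left` and telescope.
  -- The step that lands has no mark, and β is the side of the last far vertex.
  first-landing : ∀ {y z} (W : Walk G ℓ y z) → far y ≡ true → far z ≡ false →
    ∃[ w ] ∃[ β ] Landing β w × (∃₂ λ a b → a + b ≡ ℓ × Walk G b w z × Σ[ A ∈ Walk G a y w ] par A ≡ left y xor β)
  first-landing (stop _) fy fz = contradiction (trans (sym fy) fz) λ ()
  first-landing {y = y} (_∷_ {w = w} e W) fy fz with far w in fw
  ... | false = w , left y , landing e fy fw , 1 , _ , refl , W , edge e ,
        trans (cong (λ f → ((far y ∧ f) ∧ (left y xor left w)) xor false) fw) (near-end (far y) (left y) (left w))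
    where
    near-end : ∀ f l l′ → ((f ∧ false) ∧ (l xor l′)) xor false ≡ l xor l
    near-end f l l′ = trans (cong (λ x → (x ∧ (l xor l′)) xor false) (∧-zeroʳ f)) (sym (xor-same l))
  ... | true with first-landing W fw fz
  ...   | z , β , L , a , b , eq , B , A , odd = z , β , L , suc a , b , cong suc eq , B , e ∷ A ,
        trans (cong₂ _xor_ (cong₂ (λ f f′ → (f ∧ f′) ∧ (left y xor left w)) fy fw) odd)
              (xor-telescope (left y) (left w) β)

  par-even : ∀ {x y} (W : Walk G ℓ x y) → (∀ {t} → t < ℓ → χ (W ! t) (W ! suc t) ≡ false) → par W ≡ false
  par-even (stop _) _    = refl
  par-even {x = x} (_∷_ {w = w} e W) even = cong₂ _xor_
    (trans (cong (χ x) (sym (!-start W))) (even z<s)) (par-even W (λ t< → even (s<s t<)))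

  -- `proj` is constant along the descent, hence so is `left`, and `χ` vanishes.
  descent-even : ∀ {x} (x∈ : x ∈ V G) → par (descent x∈) ≡ false
  descent-even {x} x∈ = par-even (descent x∈) λ {t} t<h →
    trans (cong ((far (descent x∈ ! t) ∧ far (descent x∈ ! suc t)) ∧_)
                (trans (cong₂ _xor_ (same (<⇒≤ t<h)) (same t<h)) (xor-same (left x))))
          (∧-zeroʳ (far (descent x∈ ! t) ∧ far (descent x∈ ! suc t)))
    where
    same : ∀ {t} → t ≤ height x → left (descent x∈ ! t) ≡ left x
    same {t} t≤h with m≤n⇒∃[o]m+o≡n t≤h
    ... | e , eq = cong (λ i → toℕ i ≤ᵇ K) (split eq refl (descent x∈))
      where
      split : ∀ {h} → t + e ≡ h → h ≡ height x → (W : Walk G h x (point (proj x))) → proj (W ! t) ≡ proj x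
      split refl eq W = proj-descent eq (take t W) (drop t W)

  -- Vertices of P have height 0, so none is far and no edge of P is marked.
  fromStart : ∀ i → Σ[ W ∈ Walk G (toℕ i) u (point i) ] par W ≡ false
  fromStart i with m≤n⇒∃[o]m+o≡n (toℕ≤pred[n] i)
  ... | e , eq = initial eq P (λ t≤ → height-min (subst (Walk G 0 _) (point-clamp t≤) (stop (!∈ P _))))
    where
    initial : ∀ {t m′} → t + e ≡ m′ → (P : Walk G m′ u v) → (∀ {t} → t ≤ m′ → height (P ! t) ≤ 0) →
              Σ[ W ∈ Walk G t u (P ! t) ] par W ≡ false
    initial {t} refl P low = take t P , par-even (take t P) λ {x} x<t →
      let near = λ {y} (y≤t : y ≤ t) → subst (λ h → (K <ᵇ h) ≡ false)
                   (sym (trans (cong height (take-! t P y≤t)) (n≤0⇒n≡0 (low (≤-trans y≤t (m≤m+n t e)))))) refl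
      in cong (λ f → (f ∧ far (take t P ! suc x)) ∧ (left (take t P ! x) xor left (take t P ! suc x))) (near (<⇒≤ x<t))

  -- With even walks to the common vertex u, an odd walk between any two vertices closes up to an
  -- odd closed walk.
  toStart : ∀ {x} → x ∈ V G → ∃[ ℓ ] Σ[ W ∈ Walk G ℓ x u ] par W ≡ false
  toStart {x} x∈ =
    let (S , even) = fromStart (proj x)
    in _ , descent x∈ ++ reverse S ,
       trans (par-++ (descent x∈) (reverse S)) (cong₂ _xor_ (descent-even x∈) (trans (par-reverse S) even))

  -- Follow a shortest walk from x to the end of P on the other side.  If it
  -- landed on the side of x, it would be longer than P.
  distant⇒odd : (∀ {x y} → x ∈ V G → y ∈ V G → Within G m x y) → ∀ {x} → x ∈ V G → 3 * K < height x →
                ∃[ ℓ ] OddClosed ℓ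
  distant⇒odd diameter {x} x∈ 3K<h = result
    where
    end : Bool → ℕ
    end true  = m
    end false = 0
    end≤ : ∀ β → end β ≤ m
    end≤ true  = ≤-refl
    end≤ false = z≤n
    far-x : far x ≡ true
    far-x = dec-true (K <? height x) (≤-<-trans (m≤m+n K (2 * K)) 3K<h)
    height-end : ∀ β → height (P ! end β) ≡ 0
    height-end β = n≤0⇒n≡0 (height-min (subst (Walk G 0 _) (point-clamp (end≤ β)) (stop (!∈ P (end β)))))

    -- Reaching z takes more than 2K steps, because x is further than 3K from P and z is within K.
    -- The rest takes at least m - 2K steps, because the projection of z is at least m - K away from
    -- the end aimed at. Together this exceeds m.
    arithˡ : ∀ {a b p z h} → a + b ≤ m → 3 * K < h → h ≤ a + z → z ≤ K → p ≤ K → m ≤ p + (z + b) → ⊥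
    arithˡ {a} {b} {p} {z} {h} e f g i j l = 1+n≰n (lin {a = 1} {b = 0} 0
      (+-mono-≤ e (+-mono-≤ f (+-mono-≤ g (+-mono-≤ (+-mono-≤ i i) (+-mono-≤ j l)))))
      (solve (a ◂ b ◂ p ◂ z ◂ h ◂ K ◂ m ◂ [])))
    arithʳ : ∀ {a b p z h} → a + b ≤ m → 3 * K < h → h ≤ a + z → z ≤ K → m ≤ p + K → p ≤ b + z → ⊥
    arithʳ {a} {b} {p} {z} {h} e f g i j l = 1+n≰n (lin {a = 1} {b = 0} 0
      (+-mono-≤ e (+-mono-≤ f (+-mono-≤ g (+-mono-≤ (+-mono-≤ i i) (+-mono-≤ j l)))))
      (solve (a ◂ b ◂ p ◂ z ◂ h ◂ K ◂ m ◂ [])))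

    too-long : ∀ β {z} → Landing β z → a + b ≤ m → Walk G a x z → Walk G b z (P ! end β) → ⊥
    too-long true {z} (hz , s) ab≤m A B = arithˡ ab≤m 3K<h (height-step A) hz s
      (≤-trans (≤-reflexive (sym (toℕ-clamp {m} ≤-refl)))
        (spread {i = proj z} {clamp m m} (reverse (descent (target∈ A)) ++ subst (Walk G _ z) (point-clamp ≤-refl) B)))
    too-long {b = b} false {z} (hz , s) ab≤m A B = arithʳ ab≤m 3K<h (height-step A) hz s
      (≤-trans (spread {i = clamp m 0} {proj z} (reverse (subst (Walk G _ z) (point-clamp z≤n) B) ++ descent (target∈ A)))
               (≤-reflexive (cong (_+ (b + height z)) (toℕ-clamp {m} z≤n))))

    result : ∃[ ℓ ] OddClosed ℓ
    result with diameter x∈ (!∈ P (end (left x)))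
    ... | ℓ , ℓ≤m , W with first-landing W far-x (cong (K <ᵇ_) (height-end (left x)))
    ...   | z , β , L , a , b , eq , B , A , odd with left x xor β in same
    ...     | false = contradiction (subst (λ β → Landing β z) (sym (xor-false (left x) β same)) L)
                        λ L′ → too-long (left x) L′ (≤-trans (≤-reflexive eq) ℓ≤m) A B
      where
      xor-false : ∀ p q → p xor q ≡ false → p ≡ q
      xor-false true  true  _ = refl
      xor-false false false _ = refl
    ...     | true =
      let (_ , S , even)  = toStart (target∈ A)
          (_ , S′ , even′) = toStart x∈
      in _ , x , A ++ (S ++ reverse S′) ,
         trans (par-++ A (S ++ reverse S′)) (cong₂ _xor_ odd
           (trans (par-++ S (reverse S′)) (cong₂ _xor_ even (trans (par-reverse S′) even′))))

-- Geodesic cycles in claw-free graphs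

Conclusion : (width spread : ℕ) → Graph n → Set₁
Conclusion width spread G = ∃[ m ] Σ[ C ∈ Graph m ]
  ((IsCycle C ⊎ IsPath C) ×
   (Σ[ 𝒟 ∈ Decomposition C G ]
      (IsHonest 𝒟 × radialWidth 𝒟 ≤∞ [ width ] × radialSpread 𝒟 ≤∞ [ spread ])) ×
   QuasiIsometric 1 width C G)

weaken : ∀ {x r s} → x ≤∞ [ r ] → r ≤ s → x ≤∞ [ s ]
weaken Supremum.[ p ] r≤s = Supremum.[ ≤-trans p r≤s ]

-- The legs are the first K + 1 steps of W in either direction and of q. As N ≥ 4K + 6, the arc
-- between two points of the legs on W that avoids x has at least 2K + 4 edges, so it is no
-- shortcut.
cycleClaw : ∀ (G : Graph n) {N x} K (W : Walk G N x x) (q : ℕ → Fin n) → 4 * K + 6 ≤ N →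
  (∀ {t d ℓ} → t + d ≤ N → Walk G ℓ (W ! t) (W ! (t + d)) → d ≤ ℓ ⊎ N ≤ d + ℓ) →
  q 0 ≡ x → (∀ {t} → t < suc K → Adj G (q t) (q (suc t))) →
  (∀ {t t′ ℓ} → t ≤ suc K → t′ ≤ N → Walk G ℓ (q t) (W ! t′) → t ≤ ℓ) → HasClaw K G
cycleClaw G {N} {x} K W q N≥ isometric q₀ stepQ far = claw G (suc K) z<s
  (λ t → W ! t) (λ t → W ! (N ∸ t)) q
  (trans (!-start W) (sym (!-end W))) (trans (!-start W) (sym q₀))
  (λ t<s → !-step W (<-≤-trans t<s s≤N))
  (λ {t} t<s → subst (λ y → Adj G (W ! y) (W ! (N ∸ suc t))) (sym (∸-suc (<-≤-trans t<s s≤N)))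
     (Adj-sym G (!-step W (≤-trans (≤-reflexive (sym (∸-suc (<-≤-trans t<s s≤N)))) (m∸n≤m N t)))))
  stepQ
  (λ {t} {d} t+d≤s X → short d (m+n≤o⇒n≤o t t+d≤s) (arc t d refl (≤-trans t+d≤s s≤N) X))
  (λ {t} {d} t+d≤s X → short d (m+n≤o⇒n≤o t t+d≤s)
     (arc (N ∸ (t + d)) d (back t d t+d≤s) (m∸n≤m N t) (reverse X)))
  (λ {t} {t′} t≤s t′≤s X → across t t′ t≤s t′≤s
     (arc t (N ∸ t′ ∸ t) (m+[n∸m]≡n (gap t t′ t≤s t′≤s)) (m∸n≤m N t′) X))
  (λ t≤s t′≤s → far t≤s (≤-trans t′≤s s≤N))
  (λ {t} {t′} t≤s t′≤s → far t≤s (m∸n≤m N t′))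
  K (≤-reflexive (+-comm K 1))
  where
  2s≤N : suc K + suc K ≤ N
  2s≤N = lin (2 * K + 4) N≥ (solve (K ◂ N ◂ []))
  s≤N : suc K ≤ N
  s≤N = m+n≤o⇒m≤o (suc K) 2s≤N
  arc : ∀ t d {t′ ℓ} → t + d ≡ t′ → t′ ≤ N → Walk G ℓ (W ! t) (W ! t′) → d ≤ ℓ ⊎ N ≤ d + ℓ
  arc t d refl = isometric
  -- Since N ≥ 2(K + 1), the complementary arc is no shorter than d.
  short : ∀ d {ℓ} → d ≤ suc K → d ≤ ℓ ⊎ N ≤ d + ℓ → d ≤ ℓ
  short d d≤s (inj₁ p) = p
  short d {ℓ} d≤s (inj₂ p) = ≤-trans d≤s (+-cancelˡ-≤ (suc K) (suc K) ℓ
    (≤-trans 2s≤N (≤-trans p (+-monoˡ-≤ ℓ d≤s))))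
  back : ∀ t d → t + d ≤ suc K → N ∸ (t + d) + d ≡ N ∸ t
  back t d t+d≤s = trans (cong (_+ d) (sym (∸-+-assoc N t d)))
    (m∸n+n≡m (m+n≤o⇒m≤o∸n d (≤-trans (≤-reflexive (+-comm d t)) (≤-trans t+d≤s s≤N))))
  gap : ∀ t t′ → t ≤ suc K → t′ ≤ suc K → t ≤ N ∸ t′
  gap t t′ p q = m+n≤o⇒m≤o∸n t (≤-trans (+-mono-≤ p q) 2s≤N)
  across : ∀ t t′ {ℓ} → t ≤ suc K → t′ ≤ suc K → N ∸ t′ ∸ t ≤ ℓ ⊎ N ≤ (N ∸ t′ ∸ t) + ℓ → t + t′ ≤ 3 * ℓ
  across t t′ {ℓ} p q r = ≤-trans (bound r) (m≤m+n ℓ (2 * ℓ))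
    where
    g = N ∸ t′ ∸ t
    whole : t + g + t′ ≡ N
    whole = trans (cong (_+ t′) (m+[n∸m]≡n (gap t t′ p q))) (m∸n+n≡m (≤-trans q s≤N))
    bound : g ≤ ℓ ⊎ N ≤ g + ℓ → t + t′ ≤ ℓ
    bound (inj₁ g≤ℓ) = ≤-trans (+-mono-≤ p q) (long-gap (≤-trans N≥ (≤-reflexive (sym whole))) p q g≤ℓ)
      where
      long-gap : ∀ {t t′ g} → 4 * K + 6 ≤ t + g + t′ → t ≤ suc K → t′ ≤ suc K → g ≤ ℓ → suc K + suc K ≤ ℓ
      long-gap {t} {t′} {g} a b c d = lin 2 (+-mono-≤ a (+-mono-≤ b (+-mono-≤ c d))) (solve (t ◂ t′ ◂ g ◂ K ◂ ℓ ◂ []))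
    bound (inj₂ N≤) = wrapped (≤-trans (≤-reflexive whole) N≤)
      where
      wrapped : ∀ {g} → t + g + t′ ≤ g + ℓ → t + t′ ≤ ℓ
      wrapped {g} h = lin 0 h (solve (t ◂ t′ ◂ g ◂ ℓ ◂ []))

-- The conclusion for each kind of core: a vertex, a geodesic, a cycle.

module _ (K : ℕ) (G : Graph n) (conn : Connected G) where

  core-conclusion : (C : Graph (suc m)) → IsCycle C ⊎ IsPath C → (C∈ : ∀ i → i ∈ V C)
    (φ : Fin (suc m) → Fin n) (φ∈ : ∀ i → φ i ∈ V G) (hom : ∀ {i j} → Adj C i j → Adj G (φ i) (φ j))
    (isometric : ∀ {ℓ i j} → Walk G ℓ (φ i) (φ j) → Within C ℓ i j) →
    (∀ {x} → x ∈ V G → Voronoi.height G conn φ φ∈ x ≤ 3 * K) → Conclusion (6 * K + 2) (12 * K + 2) G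
  core-conclusion C shape C∈ φ φ∈ hom isometric dense =
    _ , C , shape
    , (decomposition r (suc r) dense midpoint , honest r (suc r) dense midpoint
      , weaken (radialWidth≤ r (suc r) dense midpoint) width
      , weaken (radialSpread≤ r (suc r) dense midpoint) spread)
    , quasiIsometric (6 * K + 2) (λ x∈ → ≤-trans (dense x∈) density)
    where
    open IsometricCore G conn C C∈ φ φ∈ hom isometric
    -- Balls of radius r + 1 give width 2r + 1 = 6K + 1 and spread 3K + 1.
    r = 3 * K
    width : suc (3 * K) + 3 * K ≤ 6 * K + 2
    width = lin 1 (z≤n {0}) (solve (K ◂ []))
    spread : suc (3 * K) ≤ 12 * K + 2
    spread = lin (9 * K + 1) (z≤n {0}) (solve (K ◂ []))
    density : 3 * K ≤ 6 * K + 2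
    density = lin (3 * K + 2) (z≤n {0}) (solve (K ◂ []))
    midpoint : ∀ {i j} → Within C (suc r + r) i j → ∃[ l ] Within C (suc r) i l × Within C (suc r) j l
    midpoint = within-midpoint C r

  -- The core is the path with the single vertex c, and its one bag is all of `V G`; hence r = 6K +
  -- 2 and a = 0.
  centre-conclusion : ∀ {c} → c ∈ V G → (∀ {x} → x ∈ V G → Within G (6 * K + 2) c x) → Conclusion (6 * K + 2) (12 * K + 2) G
  centre-conclusion {c} c∈ close =
    _ , pathGraph 0 , inj₂ (pathGraph-isPath 0)
    , (decomposition r 0 dense (λ _ → zero , trivial , trivial) , honest r 0 dense (λ _ → zero , trivial , trivial)
      , radialWidth≤ r 0 dense (λ _ → zero , trivial , trivial)
      , weaken (radialSpread≤ r 0 dense (λ _ → zero , trivial , trivial)) z≤n)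
    , quasiIsometric r dense
    where
    r = 6 * K + 2
    trivial : ∀ {i j ℓ} → Within (pathGraph 0) ℓ i j
    trivial {zero} {zero} = 0 , z≤n , stop ∈⊤
    no-edges : ∀ {i j} → Adj (pathGraph 0) i j → Adj G c c
    no-edges {zero} {zero} (inj₁ ())
    no-edges {zero} {zero} (inj₂ ())
    open IsometricCore G conn (pathGraph 0) (λ _ → ∈⊤) (λ _ → c) (λ _ → c∈)
      no-edges (λ _ → trivial)
    dense : ∀ {x} → x ∈ V G → height x ≤ r
    dense x∈ = let (_ , ℓ≤ , W) = close x∈ in ≤-trans (height-min {j = zero} (reverse W)) ℓ≤

  path-conclusion : ∀ {u v} (P : Walk G m u v) → (∀ {ℓ} → Walk G ℓ u v → m ≤ ℓ) →
    (∀ {x} → x ∈ V G → Track.height G conn P x ≤ 3 * K) → Conclusion (6 * K + 2) (12 * K + 2) G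
  path-conclusion {m = m} P geodesic dense = core-conclusion (pathGraph m) (inj₂ (pathGraph-isPath m)) (λ _ → ∈⊤)
    point (λ i → !∈ P (toℕ i))
    (λ { (inj₁ l) → step l ; (inj₂ l) → Adj-sym G (step l) })
    (pathGraph-isometric λ {_} {i} {j} {d} eq → between (toℕ i) d eq (toℕ≤pred[n] j))
    dense
    where
    open Track G conn P
    open Geodesic geodesic
    step : ∀ {i j} → consecutive i j → Adj G (point i) (point j)
    step {i} {j} eq = subst (λ y → Adj G (point i) (P ! y)) (sym eq)
      (!-step P (≤-trans (≤-reflexive (sym eq)) (toℕ≤pred[n] j)))

  module _ (noClaw : ¬ HasClaw K G) (χ : Fin n → Fin n → Bool) (χ-sym : ∀ x y → χ x y ≡ χ y x) where

    open Parity G χ χ-sym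

    -- W is isometric by minimality. If some vertex were further than K from it, then W rotated to
    -- start at the nearest point, together with the ascent from there, would satisfy `cycleClaw`.
    cycle-conclusion : ∀ {M x} (W : Walk G (suc M) x x) → par W ≡ true →
      (∀ {ℓ} → OddClosed ℓ → suc M ≤ ℓ) → 4 * K + 6 ≤ suc M → Conclusion (6 * K + 2) (12 * K + 2) G
    cycle-conclusion {M} {x} W odd shortest N≥ =
      core-conclusion (cycleGraph M 0<M) (inj₁ (cycleGraph-isCycle M 0<M 2≤M)) (λ _ → ∈⊤) φ φ∈
        (λ { (inj₁ l) → step l ; (inj₂ l) → Adj-sym G (step l) })
        (cycleGraph-isometric 0<M λ {_} {i} {j} {d} eq →
           arc (toℕ i) d eq (<⇒≤ (toℕ<n j)))
        (λ y∈ → ≤-trans (≮⇒≥ (λ K<h → noClaw (spiked y∈ K<h))) (m≤m+n K (2 * K)))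
      where
      2≤M : 2 ≤ M
      2≤M = ≤-pred (≤-trans (≤-trans (s≤s (s≤s (s≤s z≤n))) (m≤n+m 6 (4 * K))) N≥)
      0<M : 0 < M
      0<M = ≤-trans (s≤s z≤n) 2≤M
      φ : Fin (suc M) → Fin n
      φ i = W ! toℕ i
      φ∈ : ∀ i → φ i ∈ V G
      φ∈ i = !∈ W (toℕ i)
      open Voronoi G conn φ φ∈

      arc : ∀ t d {t′ ℓ} → t + d ≡ t′ → t′ ≤ suc M → Walk G ℓ (W ! t) (W ! t′) → d ≤ ℓ ⊎ suc M ≤ d + ℓ
      arc t d refl = shortest-isometric shortest W odd

      step : ∀ {i j} → consecutive i j ⊎ (toℕ i ≡ M × toℕ j ≡ 0) → Adj G (φ i) (φ j)
      step {i} {j} (inj₁ eq) = subst (λ y → Adj G (φ i) (W ! y)) (sym eq) (!-step W (toℕ<n i))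
      step {i} {j} (inj₂ (p , q)) = subst₂ (Adj G) (cong (W !_) (sym p))
        (trans (trans (!-end W) (sym (!-start W))) (cong (W !_) (sym q))) (!-step W (n<1+n M))

      -- The final position M + 1 is the base point again, which has index 0.
      index : ∀ {t} → t ≤ suc M → ∃[ i ] W ! t ≡ φ i
      index {t} t≤ with m≤n⇒m<n∨m≡n t≤
      ... | inj₁ (s≤s t≤M) = clamp M t , cong (W !_) (sym (toℕ-clamp t≤M))
      ... | inj₂ refl = zero , trans (!-end W) (sym (!-start W))

      spiked : ∀ {y} → y ∈ V G → K < height y → HasClaw K G
      spiked {y} y∈ K<h with m≤n⇒∃[o]m+o≡n (<⇒≤ (toℕ<n (proj y)))
      ... | e , eq = rotated eq W refl odd shortest index N≥
        where
        c = toℕ (proj y)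
        Q = descent y∈
        rotated : ∀ {N} → c + e ≡ N → (W′ : Walk G N x x) → W′ ! c ≡ φ (proj y) → par W′ ≡ true → (∀ {ℓ} → OddClosed ℓ → N ≤ ℓ) →
                  (∀ {t} → t ≤ N → ∃[ i ] W′ ! t ≡ φ i) → 4 * K + 6 ≤ N → HasClaw K G
        rotated refl W′ at-c odd′ shortest′ index′ N′≥ =
          cycleClaw G K (rotate c W′) (reverse Q !_) (≤-trans N′≥ (≤-reflexive (+-comm c e)))
            (shortest-isometric (λ O → ≤-trans (≤-reflexive (+-comm e c)) (shortest′ O)) (rotate c W′)
              (trans (par-rotate c W′) odd′))
            (trans (!-start (reverse Q)) (sym at-c))
            (λ t<s → !-step (reverse Q) (<-≤-trans t<s K<h))
            (λ {t} {t′} {ℓ} t≤s t′≤N X →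
              let (t″ , t″≤ , eq′) = rotate-! c W′ t′≤N
                  (i , eq″) = index′ t″≤
              in ascent Q (≤-trans t≤s K<h) (subst (Walk G ℓ (reverse Q ! t)) (trans eq′ eq″) X))

-- The dichotomy

-- Take the least m such that all vertices are pairwise within m. If m > 0, some pair is not within
-- m - 1, and a walk of at most m steps between the two is a geodesic of length m.
diametralWalk : (G : Graph n) → Connected G → ∃[ m ] ∃₂ λ u v → Walk G m u v ×
  (∀ {ℓ} → Walk G ℓ u v → m ≤ ℓ) × (∀ {x y} → x ∈ V G → y ∈ V G → Within G m x y)
diametralWalk {n} G conn = attain (leastNat allWithin? bounded)
  where
  AllWithin : ℕ → Set
  AllWithin b = ∀ x y → x ∈ V G → y ∈ V G → Within G b x y

  allWithin? : ∀ b → Dec (AllWithin b)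
  allWithin? b = all? λ x → all? λ y → (x ∈? V G) →-dec ((y ∈? V G) →-dec within? G b x y)

  bounded : AllWithin n
  bounded x y x∈ y∈ =
    let P = walk⇒path G (proj₂ (Connected.joined conn x∈ y∈))
    in length P , <⇒≤ (injective⇒≤ (simple P)) , walk P

  Apart : ℕ → Set
  Apart b = ∃₂ λ x y → x ∈ V G × y ∈ V G × ¬ Within G b x y

  apart? : ∀ b → Dec (Apart b)
  apart? b = any? λ x → any? λ y → (x ∈? V G) ×-dec ((y ∈? V G) ×-dec ¬? (within? G b x y))

  attain : ∃[ m ] AllWithin m × (∀ {b} → AllWithin b → m ≤ b) →
           ∃[ m ] ∃₂ λ u v → Walk G m u v × (∀ {ℓ} → Walk G ℓ u v → m ≤ ℓ) ×
           (∀ {x y} → x ∈ V G → y ∈ V G → Within G m x y)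
  attain (zero , all , min) =
    let (u , u∈) = Connected.nonempty conn
    in 0 , u , u , stop u∈ , (λ _ → z≤n) , all _ _
  attain (suc b , all , min) with apart? b
  ... | no ¬apart = contradiction
          (min λ x y x∈ y∈ → decidable-stable (within? G b x y) λ ¬w → ¬apart (x , y , x∈ , y∈ , ¬w)) 1+n≰n
  ... | yes (x , y , x∈ , y∈ , ¬w) with all x y x∈ y∈
  ...   | ℓ , ℓ≤ , W = suc b , x , y , subst (λ l → Walk G l x y) (≤-antisym ℓ≤ (geodesic W)) W , geodesic , all _ _
    where
    geodesic : ∀ {ℓ} → Walk G ℓ x y → suc b ≤ ℓ
    geodesic {ℓ} X = ≰⇒> λ ℓ≤b → ¬w (ℓ , ℓ≤b , X)

structure : ∀ K (G : Graph n) → Connected G → ¬ HasClaw K G → Conclusion (6 * K + 2) (12 * K + 2) G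
structure K G conn noClaw with diametralWalk G conn
... | m , u , v , P , geodesic , diameter with m ≤? 6 * K + 2
...   | yes m≤ = centre-conclusion K G conn (source∈ P) λ x∈ →
        let (ℓ , ℓ≤m , W) = diameter (source∈ P) x∈ in ℓ , ≤-trans ℓ≤m m≤ , W
...   | no m≰ with any? (λ x → (x ∈? V G) ×-dec (3 * K <? Track.height G conn P x))
...     | no ¬high = path-conclusion K G conn P geodesic λ {x} x∈ → ≮⇒≥ λ high → ¬high (x , x∈ , high)
...     | yes (x , x∈ , high) = onCycle (shortestOddClosed (proj₂ (distant⇒odd diameter x∈ high)))
  where
  m≥ : 6 * K + 3 ≤ m
  m≥ = ≤-trans (≤-reflexive (+-suc (6 * K) 2)) (≰⇒> m≰)
  open Sides K G conn noClaw P geodesic m≥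
  onCycle : ∃[ N ] OddClosed N × (∀ {ℓ} → OddClosed ℓ → N ≤ ℓ) → Conclusion (6 * K + 2) (12 * K + 2) G
  onCycle (N , (y , W , odd) , shortest) = go N W odd shortest
    (N≥ m≥ (odd-long (y , W , odd)))
    where
    -- 2(6K + 3) - 8K = 4K + 6, the length that `cycleClaw` requires.
    N≥ : ∀ {m} → 6 * K + 3 ≤ m → 2 * m ≤ 8 * K + N → 4 * K + 6 ≤ N
    N≥ {m} p q = lin 0 (+-mono-≤ (+-mono-≤ p p) q) (solve (m ◂ K ◂ N ◂ []))
    go : ∀ N → (W : Walk G N y y) → par W ≡ true → (∀ {ℓ} → OddClosed ℓ → N ≤ ℓ) → 4 * K + 6 ≤ N →
         Conclusion (6 * K + 2) (12 * K + 2) G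
    go zero    W odd shortest le = contradiction (m+n≤o⇒n≤o (4 * K) le) λ ()
    go (suc M) W odd shortest le = cycle-conclusion K G conn noClaw χ χ-sym W odd shortest le

theorem3 : (k : ℕ) {n : ℕ} (G : Graph n) → Connected G →
    ¬ (Σ[ Y ∈ Graph n ] (Y ⊑ G × IsSubdivision≥ (3 * k) K₁,₃ Y × Y IsQuasiGeodesicIn G [ 3 ])) →
    ∃[ m ] Σ[ C ∈ Graph m ]
    ((IsCycle C ⊎ IsPath C) ×
    (Σ[ 𝒟 ∈ Decomposition C G ]
    (IsHonest 𝒟 × radialWidth 𝒟 ≤∞ [ 18 * k + 2 ] × radialSpread 𝒟 ≤∞ [ 36 * k + 2 ])) ×
    QuasiIsometric 1 (18 * k + 2) C G)
-- For K = 3k the bounds 6K and 12K are 18k and 36k.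
theorem3 k G conn noClaw = subst₂ (λ w s → Conclusion (w + 2) (s + 2) G)
  (sym (*-assoc 6 3 k)) (sym (*-assoc 12 3 k)) (structure (3 * k) G conn noClaw)
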